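{- For every positive integer $n$, $$\sum_{k=0}^{n-1} q^k \begin{bmatrix} 2k \\ k \end{bmatrix}_q \equiv \left(\frac{n}{3}\right) q^{\frac{n^2-1}{3}} \pmod{\Phi_n(q)^2}.$$
   Context: The Gaussian $q$-binomial coefficient is $\begin{bmatrix} n \\ k \end{bmatrix}_q=\frac{(q;q)_n}{(q;q)_k(q;q)_{n-k}}$ for $0\le k\le n$ and $0$ otherwise, where $(a;q)_m=(1-a)(1-aq)\cdots(1-aq^{m-1})$ for $m\ge1$ and $(a;q)_0=1$. For an integer $m$, $\left(\frac{m}{3}\right)$ is the Legendre symbol modulo 3: $1$ if $m\equiv1\pmod 3$, $-1$ if $m\equiv 2\pmod 3$, $0$ if $3\mid m$ (so the right-hand side is $0$ when $3\mid n$, and otherwise $(n^2-1)/3$ is an integer). $\Phi_n(q)=\prod_{1\le k\le n,\ \gcd(n,k)=1}(q-e^{2\pi i k/n})$ is the $n$th cyclotomic polynomial, and the congruence is divisibility of the difference by $\Phi_n(q)^2$ in $\mathbb{Z}[q]$. -}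

module Defs where

open import Data.Nat as ℕ using (ℕ; zero; suc; _∸_; _≤_; _<_)
open import Data.Nat.DivMod using (_/_; _%_)
open import Data.Nat.Divisibility using (_∣?_)
open import Data.Integer as ℤ using (ℤ; +_; -_)
open import Data.List using (List; []; _∷_; replicate; _++_; map)
open import Data.Product using (Σ; _×_)
open import Data.Bool using (if_then_else_)
open import Relation.Nullary using (does)
open import Relation.Binary.PropositionalEquality using (_≡_)

-- Polynomials in ℤ[q], as coefficient lists (constant term first).
-- Equality is coefficientwise, so trailing zeros are irrelevant.
Poly : Set
Poly = List ℤ

coeff : Poly → ℕ → ℤ
coeff []      _       = + 0
coeff (a ∷ p) zero    = a
coeff (a ∷ p) (suc i) = coeff p i

infix 4 _≈_
_≈_ : Poly → Poly → Set
P ≈ Q = ∀ i → coeff P i ≡ coeff Q i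

infixl 6 _⊕_ _⊖_
infixl 7 _⊗_

_⊕_ : Poly → Poly → Poly
[]      ⊕ q       = q
(a ∷ p) ⊕ []      = a ∷ p
(a ∷ p) ⊕ (b ∷ q) = (a ℤ.+ b) ∷ (p ⊕ q)

neg : Poly → Poly
neg = map (-_)

_⊖_ : Poly → Poly → Poly
p ⊖ q = p ⊕ neg q

_⊗_ : Poly → Poly → Poly
[]      ⊗ q = []
(a ∷ p) ⊗ q = map (a ℤ.*_) q ⊕ (+ 0 ∷ (p ⊗ q))

C : ℤ → Poly
C c = c ∷ []

one : Poly
one = C (+ 1)

X^ : ℕ → Poly
X^ k = replicate k (+ 0) ++ (+ 1 ∷ [])

infix 4 _∣ₚ_
_∣ₚ_ : Poly → Poly → Set
P ∣ₚ Q = Σ Poly (λ R → Q ≈ P ⊗ R)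

qpoch : ℕ → Poly
qpoch zero    = one
qpoch (suc m) = qpoch m ⊗ (one ⊖ X^ (suc m))

-- B is the Gaussian binomial coefficient: B n k · (q;q)_k (q;q)_{n-k} = (q;q)_n
-- for 0 ≤ k ≤ n (this determines B n k uniquely, ℤ[q] being a domain), and 0 otherwise.
IsQBinomial : (ℕ → ℕ → Poly) → Set
IsQBinomial B = ∀ n k →
  (k ≤ n → B n k ⊗ (qpoch k ⊗ qpoch (n ∸ k)) ≈ qpoch n) × (n < k → B n k ≈ [])

divProd : (ℕ → Poly) → ℕ → ℕ → Poly
divProd Φ n zero    = one
divProd Φ n (suc d) =
  if does (suc d ∣? n) then Φ (suc d) ⊗ divProd Φ n d else divProd Φ n d

-- Φ is the family of cyclotomic polynomials: ∏_{d ∣ n} Φ_d = q^n - 1 for all n ≥ 1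
-- (this determines Φ_n uniquely for every n ≥ 1).
IsCyclotomic : (ℕ → Poly) → Set
IsCyclotomic Φ = ∀ n → 1 ≤ n → divProd Φ n n ≈ X^ n ⊖ one

leg3 : ℕ → ℤ
leg3 n with n % 3
... | 0 = + 0
... | 1 = + 1
... | _ = - (+ 1)

lhsSum : (ℕ → ℕ → Poly) → ℕ → Poly
lhsSum B zero    = []
lhsSum B (suc m) = lhsSum B m ⊕ X^ m ⊗ B (m ℕ.+ m) m

rhsTerm : ℕ → Poly
rhsTerm n = C (leg3 n) ⊗ X^ ((n ℕ.* n ∸ 1) / 3)

{-# OPTIONS --safe #-}
module Submission where

open import Defs hiding (_≈_)
open import Data.Nat using (ℕ; _≤_)

open import Algebra.Bundles using (CommutativeRing; RawRing)
open import Algebra.Solver.Ring.AlmostCommutativeRing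
  using (_-Raw-AlmostCommutative⟶_; fromCommutativeRing)
open import Data.Integer as ℤ using (ℤ; +_; -[1+_])
import Data.Integer.Properties as ℤP
open import Data.Integer.Tactic.RingSolver using () renaming (solve-∀ to ℤ-solve-∀)
open import Data.Bool using (if_then_else_)
open import Data.List using ([]; _∷_; map; drop)
open import Data.Maybe using (Maybe; just; nothing)
open import Data.Nat as ℕ using (zero; suc; _∸_; _<_; s≤s; z≤n)
open import Data.Nat.DivMod using (_/_; _%_; m≡m%n+[m/n]*n; m%n<n; m*n/n≡m)
open import Data.Nat.Divisibility
  using (_∣_; _∤_; _∣?_; >⇒∤; divides; ∣⇒≤; ∣-trans; ∣-refl; ∣m+n∣m⇒∣n; m∣m*n; n∣m*n)
open import Data.Nat.GCD using (gcd; gcd-GCD; gcd[m,n]∣m; gcd[m,n]∣n; module Bézout)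
import Data.Nat.Properties as ℕP
open import Data.Nat.Tactic.RingSolver using (solve-∀)
open import Data.Product using (∃; _,_; proj₁; proj₂)
open import Data.Sum using (_⊎_; inj₁; inj₂)
open import Function using (_∘_)
open import Level using (0ℓ)
open import Relation.Binary.PropositionalEquality as ≡ using (_≡_)
open import Relation.Nullary using (yes; no; contradiction)
open import Relation.Nullary.Decidable using (dec-true; dec-false)

-- Write [N, k] for the Gaussian binomial. Pascal's rule gives, by induction on n, the exact identity
--   Σ_{k<n} q^k [2k, k] = Σ_{j ≡ 1 mod 3} sgn(j) q^((2j² - j - 1)/3) [2n, n + j].
-- Modulo Φ_n², the binomial for 0 < |j| < n is 2 sgn(j) (1 - q^n) (-1)^(j+1) q^(-j(j-1)/2) / (1 - q^j),
-- so these terms add up to 2 (1 - q^n) times a truncated Appell sum, needed only modulo Φ_n, where q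
-- is a primitive n-th root of unity. If 3 divides n, a reflection of the index cancels the sum. If not,
-- a recurrence in its length turns it into the Lambert sum of x^u / (1 - x^u), x = q⁻³, over an
-- interval stable under u ↦ n - u, and x^u / (1 - x^u) + x^(n-u) / (1 - x^(n-u)) = -1. The term with
-- |j| = n gives the power of q on the right-hand side, up to a multiple of 1 - q^n that the Appell sum
-- cancels. Instead of 1 / (1 - t) we use n / (1 - t), a polynomial in t for t^n = 1; the factor n is
-- removed at the end because Φ_n(0) is a unit.

-- The root of unity is never a complex number: it is the class of q in R/(φ), and what is asked of
-- it, besides q^n = 1, is that 1 - q^k can be cancelled whenever n does not divide k. The rings R,
-- R/(φ) and R/(φ²) share elements and operations, so one expression can be reduced by either
-- modulus. This matters because 1 - q^n vanishes modulo φ and has to be cancelled in R before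
-- reduction, while the cofactor of a multiple of φ may be computed modulo φ only. The pairing u ↦ n
-- - u may fix u = n/2, so it yields twice the Lambert sum; the 2 in front of the Appell sum, which
-- is the value of [2n, n] modulo φ, makes exactly that double sum appear. The Legendre symbol comes
-- from the exact identity: among j = n and j = -n the one congruent to 1 modulo 3 is n, -n or
-- absent according to n modulo 3, and sgn(j) is its sign.

ℤ-rawRing : RawRing 0ℓ 0ℓ
ℤ-rawRing = CommutativeRing.rawRing ℤP.+-*-commutativeRing

-- Integer coefficients for the ring solver.

module IntegerMultiples (R : CommutativeRing 0ℓ 0ℓ) where
  open CommutativeRing R hiding (zero)
  open import Algebra.Properties.Ring ring using (-0#≈0#; -‿distribˡ-*; -‿distribʳ-*; -‿involutive; -‿+-comm)
  open import Algebra.Properties.Semiring.Mult.TCOptimised semiring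
  open import Relation.Binary.Reasoning.Setoid setoid

  -- With the optimised multiples, `ι (+ 0)` and `ι (+ 1)` reduce to `0#` and `1#`, so the constants
  -- of the solver match the goals literally.
  ι : ℤ → Carrier
  ι (+ n)    = n × 1#
  ι -[1+ n ] = - (suc n × 1#)

  ι-neg : ∀ a → ι (ℤ.- a) ≈ - ι a
  ι-neg (+ zero)  = sym -0#≈0#
  ι-neg (+ suc n) = refl
  ι-neg -[1+ n ]  = sym (-‿involutive _)

  ι-⊖ : ∀ m n → ι (m ℤ.⊖ n) ≈ m × 1# - n × 1#
  ι-⊖ m       zero    = sym (trans (+-congˡ -0#≈0#) (+-identityʳ _))
  ι-⊖ zero    (suc n) = sym (+-identityˡ _)
  ι-⊖ (suc m) (suc n) = begin
    ι (suc m ℤ.⊖ suc n)                  ≡⟨ ≡.cong ι (ℤP.[1+m]⊖[1+n]≡m⊖n m n) ⟩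
    ι (m ℤ.⊖ n)                          ≈⟨ ι-⊖ m n ⟩
    m × 1# - n × 1#                      ≈⟨ +-congʳ (trans (+-congʳ (-‿inverseʳ 1#)) (+-identityˡ _)) ⟨
    1# - 1# + m × 1# - n × 1#            ≈⟨ +-congʳ (trans (+-assoc _ _ _)
        (trans (+-congˡ (+-comm _ _)) (sym (+-assoc _ _ _)))) ⟩
    1# + m × 1# - 1# - n × 1#            ≈⟨ trans (+-assoc _ _ _) (+-congˡ (-‿+-comm 1# (n × 1#))) ⟩
    1# + m × 1# - (1# + n × 1#)          ≈⟨ +-cong (1+× m 1#) (-‿cong (1+× n 1#)) ⟨
    suc m × 1# - suc n × 1#              ∎

  ι-+ : ∀ a b → ι (a ℤ.+ b) ≈ ι a + ι b
  ι-+ (+ m)    (+ n)    = ×-homo-+ 1# m n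
  ι-+ (+ m)    -[1+ n ] = ι-⊖ m (suc n)
  ι-+ -[1+ m ] (+ n)    = trans (ι-⊖ n (suc m)) (+-comm _ _)
  ι-+ -[1+ m ] -[1+ n ] = begin
    - ((suc (suc (m ℕ.+ n))) × 1#)       ≡⟨ ≡.cong (λ k → - (suc k × 1#)) (ℕP.+-suc m n) ⟨
    - ((suc m ℕ.+ suc n) × 1#)           ≈⟨ -‿cong (×-homo-+ 1# (suc m) (suc n)) ⟩
    - (suc m × 1# + suc n × 1#)          ≈⟨ -‿+-comm _ _ ⟨
    - (suc m × 1#) - suc n × 1#          ∎

  ι-pos-* : ∀ m b → ι (+ m ℤ.* b) ≈ ι (+ m) * ι b
  ι-pos-* m (+ n) = trans (reflexive (≡.cong ι (≡.sym (ℤP.pos-* m n)))) (×1-homo-* m n)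
  ι-pos-* m -[1+ n ] = begin
    ι (+ m ℤ.* (ℤ.- (+ suc n)))          ≡⟨ ≡.cong ι (ℤP.neg-distribʳ-* (+ m) (+ suc n)) ⟨
    ι (ℤ.- (+ m ℤ.* (+ suc n)))          ≈⟨ ι-neg (+ m ℤ.* (+ suc n)) ⟩
    - ι (+ m ℤ.* (+ suc n))              ≈⟨ -‿cong (ι-pos-* m (+ suc n)) ⟩
    - (ι (+ m) * (suc n × 1#))           ≈⟨ -‿distribʳ-* _ _ ⟩
    ι (+ m) * - (suc n × 1#)             ∎

  ι-* : ∀ a b → ι (a ℤ.* b) ≈ ι a * ι b
  ι-* (+ m)    b = ι-pos-* m b
  ι-* -[1+ m ] b = begin
    ι ((ℤ.- (+ suc m)) ℤ.* b)            ≡⟨ ≡.cong ι (ℤP.neg-distribˡ-* (+ suc m) b) ⟨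
    ι (ℤ.- (+ suc m ℤ.* b))              ≈⟨ ι-neg (+ suc m ℤ.* b) ⟩
    - ι (+ suc m ℤ.* b)                  ≈⟨ -‿cong (ι-pos-* (suc m) b) ⟩
    - ((suc m × 1#) * ι b)               ≈⟨ -‿distribˡ-* _ _ ⟩
    - (suc m × 1#) * ι b                 ∎

  homomorphism : ℤ-rawRing -Raw-AlmostCommutative⟶ fromCommutativeRing R
  homomorphism = record
    { ⟦_⟧ = ι ; +-homo = ι-+ ; *-homo = ι-* ; -‿homo = ι-neg ; 0-homo = refl ; 1-homo = refl }

  ι-≟ : ∀ a b → Maybe (ι a ≈ ι b)
  ι-≟ a b with a ℤ.≟ b
  ... | yes ≡.refl = just refl
  ... | no _       = nothing

-- Powers and sums depend on the operations of a ring only, not on its equality, so they are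
-- literally the same in a ring and in its quotients.
accumulate : {A : Set} → (A → A → A) → A → ℕ → (ℕ → A) → A
accumulate _∙_ ε zero    f = ε
accumulate _∙_ ε (suc n) f = accumulate _∙_ ε n f ∙ f n

iterate : {A : Set} → (A → A) → A → ℕ → A
iterate f a zero    = a
iterate f a (suc n) = f (iterate f a n)

-- Powers and finite sums in a commutative ring.

module Arithmetic (R : CommutativeRing 0ℓ 0ℓ) where
  open CommutativeRing R public hiding (zero)
  open IntegerMultiples R using (homomorphism; ι-≟)
  open import Algebra.Solver.Ring ℤ-rawRing (fromCommutativeRing R) homomorphism ι-≟ public
    using (solve; _:=_; _:+_; _:*_; _:-_; :-_; con)
  open import Relation.Binary.Reasoning.Setoid setoid public

  infixr 8 _^_
  _^_ : Carrier → ℕ → Carrier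
  x ^ k = iterate (x *_) 1# k

  ∑ : ℕ → (ℕ → Carrier) → Carrier
  ∑ = accumulate _+_ 0#

  ^-congˡ : ∀ k {x y} → x ≈ y → x ^ k ≈ y ^ k
  ^-congˡ zero    h = refl
  ^-congˡ (suc k) h = *-cong h (^-congˡ k h)

  ^-congʳ : ∀ x {j k} → j ≡ k → x ^ j ≈ x ^ k
  ^-congʳ x ≡.refl = refl

  ^-homo-* : ∀ x j k → x ^ (j ℕ.+ k) ≈ x ^ j * x ^ k
  ^-homo-* x zero    k = sym (*-identityˡ _)
  ^-homo-* x (suc j) k = trans (*-congˡ (^-homo-* x j k)) (sym (*-assoc _ _ _))

  ^-distrib-* : ∀ x y k → (x * y) ^ k ≈ x ^ k * y ^ k
  ^-distrib-* x y zero    = sym (*-identityˡ 1#)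
  ^-distrib-* x y (suc k) = trans (*-congˡ (^-distrib-* x y k))
    (solve 4 (λ a b c d → a :* b :* (c :* d) := a :* c :* (b :* d)) refl x y (x ^ k) (y ^ k))


  x-y≈0⇒x≈y : ∀ {a b} → a - b ≈ 0# → a ≈ b
  x-y≈0⇒x≈y {a} {b} h = begin
    a          ≈⟨ solve 2 (λ a b → a := a :- b :+ b) refl a b ⟩
    a - b + b  ≈⟨ +-congʳ h ⟩
    0# + b     ≈⟨ +-identityˡ b ⟩
    b          ∎

  1^ : ∀ k → 1# ^ k ≈ 1#
  1^ zero    = refl
  1^ (suc k) = trans (*-identityˡ _) (1^ k)

  ^-assocʳ : ∀ x j k → (x ^ j) ^ k ≈ x ^ (j ℕ.* k)
  ^-assocʳ x zero    k = 1^ k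
  ^-assocʳ x (suc j) k = trans (^-distrib-* x (x ^ j) k)
    (trans (*-congˡ (^-assocʳ x j k)) (sym (^-homo-* x k (j ℕ.* k))))

  ^-≡1 : ∀ {a} k → a ≈ 1# → a ^ k ≈ 1#
  ^-≡1 k h = trans (^-congˡ k h) (1^ k)

  ∑-cong : ∀ n {f g} → (∀ i → i < n → f i ≈ g i) → ∑ n f ≈ ∑ n g
  ∑-cong zero    h = refl
  ∑-cong (suc n) h =
    +-cong (∑-cong n (λ i i<n → h i (ℕP.m<n⇒m<1+n i<n))) (h n (ℕP.n<1+n n))

  ∑-+ : ∀ n f g → ∑ n (λ i → f i + g i) ≈ ∑ n f + ∑ n g
  ∑-+ zero    f g = sym (+-identityˡ 0#)
  ∑-+ (suc n) f g = trans (+-congʳ (∑-+ n f g))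
    (solve 4 (λ a b c d → a :+ b :+ (c :+ d) := a :+ c :+ (b :+ d)) refl
      (∑ n f) (∑ n g) (f n) (g n))

  ∑-* : ∀ n c f → ∑ n (λ i → c * f i) ≈ c * ∑ n f
  ∑-* zero    c f = sym (zeroʳ c)
  ∑-* (suc n) c f = trans (+-congʳ (∑-* n c f)) (sym (distribˡ c _ _))

  ∑-0 : ∀ n → ∑ n (λ _ → 0#) ≈ 0#
  ∑-0 zero    = refl
  ∑-0 (suc n) = trans (+-identityʳ _) (∑-0 n)

  ∑-head : ∀ n f → ∑ (suc n) f ≈ f 0 + ∑ n (λ i → f (suc i))
  ∑-head zero    f = +-comm 0# (f 0)
  ∑-head (suc n) f = trans (+-congʳ (∑-head n f)) (+-assoc _ _ _)

  ∑-split : ∀ m n f → ∑ (m ℕ.+ n) f ≈ ∑ m f + ∑ n (λ i → f (m ℕ.+ i))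
  ∑-split zero    n f = sym (+-identityˡ _)
  ∑-split (suc m) n f = begin
    ∑ (suc (m ℕ.+ n)) f                                           ≈⟨ ∑-head (m ℕ.+ n) f ⟩
    f 0 + ∑ (m ℕ.+ n) (λ i → f (suc i))                           ≈⟨ +-congˡ (∑-split m n (λ i → f (suc i))) ⟩
    f 0 + (∑ m (λ i → f (suc i)) + ∑ n (λ i → f (suc (m ℕ.+ i)))) ≈⟨ +-assoc _ _ _ ⟨
    f 0 + ∑ m (λ i → f (suc i)) + ∑ n (λ i → f (suc (m ℕ.+ i)))   ≈⟨ +-congʳ (∑-head m f) ⟨
    ∑ (suc m) f + ∑ n (λ i → f (suc (m ℕ.+ i)))                   ∎

  ∑-reverse : ∀ n {f g} → (∀ i j → suc (i ℕ.+ j) ≡ n → f i ≈ g j) → ∑ n f ≈ ∑ n g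
  ∑-reverse zero            h = refl
  ∑-reverse (suc n) {f} {g} h = begin
    ∑ n f + f n                      ≈⟨ +-cong (∑-reverse n (λ i j e → h i (suc j)
                                          (≡.cong suc (≡.trans (ℕP.+-suc i j) e))))
                                          (h n 0 (≡.cong suc (ℕP.+-identityʳ n))) ⟩
    ∑ n (λ j → g (suc j)) + g 0      ≈⟨ +-comm _ _ ⟩
    g 0 + ∑ n (λ j → g (suc j))      ≈⟨ ∑-head n g ⟨
    ∑ (suc n) g                      ∎

  ∑-telescope : ∀ n (f : ℕ → Carrier) → ∑ n (λ i → f i - f (suc i)) ≈ f 0 - f n
  ∑-telescope zero    f = sym (-‿inverseʳ (f 0))
  ∑-telescope (suc n) f = trans (+-congʳ (∑-telescope n f))
    (solve 3 (λ a b c → a :- b :+ (b :- c) := a :- c) refl (f 0) (f n) (f (suc n)))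

  infixl 8 _·1
  _·1 : ℕ → Carrier
  n ·1 = ∑ n (λ _ → 1#)

  [_] : ℕ → Carrier → Carrier
  [ n ] t = ∑ n (t ^_)

  geometric : ∀ n t → (1# - t) * [ n ] t ≈ 1# - t ^ n
  geometric zero    t = solve 1 (λ t → (con (+ 1) :- t) :* con (+ 0) := con (+ 1) :- con (+ 1)) refl t
  geometric (suc n) t = begin
    (1# - t) * ([ n ] t + t ^ n)            ≈⟨ distribˡ _ _ _ ⟩
    (1# - t) * [ n ] t + (1# - t) * t ^ n   ≈⟨ +-congʳ (geometric n t) ⟩
    1# - t ^ n + (1# - t) * t ^ n           ≈⟨ solve 2 (λ t p → con (+ 1) :- p :+ (con (+ 1) :- t) :* p := con
        (+ 1) :- t :* p) refl t (t ^ n) ⟩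
    1# - t * t ^ n                          ∎

-- Gaussian binomials and the exact identity for the central sum.

module Gaussian (R : CommutativeRing 0ℓ 0ℓ) (q : CommutativeRing.Carrier R) where
  open Arithmetic R

  -- Pascal's rule as a definition makes sense in every commutative ring; `G-qfact` links it to the
  -- quotient of q-factorials.
  G : ℕ → ℕ → Carrier
  G _       zero    = 1#
  G zero    (suc k) = 0#
  G (suc N) (suc k) = G N k + q ^ suc k * G N (suc k)

  G-zero : ∀ {N k} → N < k → G N k ≈ 0#
  G-zero {zero}  {suc k} _         = refl
  G-zero {suc N} {suc k} (s≤s N<k) = begin
    G N k + q ^ suc k * G N (suc k)  ≈⟨ +-cong (G-zero N<k) (*-congˡ (G-zero (ℕP.m<n⇒m<1+n N<k))) ⟩
    0# + q ^ suc k * 0#              ≈⟨ solve 1 (λ a → con (+ 0) :+ a :* con (+ 0) := con (+ 0)) refl (q ^ suc k) ⟩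
    0#                               ∎

  G-diag : ∀ N → G N N ≈ 1#
  G-diag zero    = refl
  G-diag (suc N) = begin
    G N N + q ^ suc N * G N (suc N)  ≈⟨ +-cong (G-diag N) (*-congˡ (G-zero (ℕP.n<1+n N))) ⟩
    1# + q ^ suc N * 0#              ≈⟨ solve 1 (λ a → con (+ 1) :+ a :* con (+ 0) := con (+ 1)) refl (q ^ suc N) ⟩
    1#                               ∎

  -- The mirror image of the defining rule. In the inductive step both binomials are expanded by the
  -- mirror rule, and the four terms regroup by the defining one.
  G-pascalʳ : ∀ k d → G (suc (k ℕ.+ d)) (suc k) ≈ q ^ d * G (k ℕ.+ d) k + G (k ℕ.+ d) (suc k)
  G-pascalʳ zero zero = solve 1 (λ a → con (+ 1) :+ a :* con (+ 0) := con (+ 1) :* con (+ 1) :+ con (+ 0)) refl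
      (q ^ 1)
  G-pascalʳ zero (suc d) = begin
    1# + q ^ 1 * G (suc d) 1
      ≈⟨ +-congˡ (*-congˡ (G-pascalʳ 0 d)) ⟩
    1# + q ^ 1 * (q ^ d * 1# + G d 1)
      ≈⟨ solve 3 (λ q p g → con (+ 1) :+ (q :* con (+ 1)) :* (p :* con (+ 1) :+ g)
                 := q :* p :* con (+ 1) :+ (con (+ 1) :+ (q :* con (+ 1)) :* g)) refl q (q ^ d) (G d 1) ⟩
    q ^ suc d * 1# + (1# + q ^ 1 * G d 1) ∎
  G-pascalʳ (suc k) zero = begin
    G (suc (k ℕ.+ 0)) (suc k) + q ^ suc (suc k) * G (suc (k ℕ.+ 0)) (suc (suc k))
      ≈⟨ +-congˡ (*-congˡ z) ⟩
    G (suc (k ℕ.+ 0)) (suc k) + q ^ suc (suc k) * 0#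
      ≈⟨ solve 2 (λ g p → g :+ p :* con (+ 0) := con (+ 1) :* g :+ con (+ 0)) refl _ _ ⟩
    1# * G (suc (k ℕ.+ 0)) (suc k) + 0#
      ≈⟨ +-congˡ z ⟨
    1# * G (suc (k ℕ.+ 0)) (suc k) + G (suc (k ℕ.+ 0)) (suc (suc k)) ∎
    where
    z : G (suc (k ℕ.+ 0)) (suc (suc k)) ≈ 0#
    z = G-zero (s≤s (s≤s (ℕP.≤-reflexive (ℕP.+-identityʳ k))))
  G-pascalʳ (suc k) (suc d) rewrite ℕP.+-suc k d = begin
    G (suc N) (suc k) + q ^ (2 ℕ.+ k) * G (suc N) (2 ℕ.+ k)
      ≈⟨ +-cong h₁ (*-congˡ (G-pascalʳ (suc k) d)) ⟩
    q ^ suc d * G N k + G N (suc k) + q ^ (2 ℕ.+ k) * (q ^ d * G N (suc k) + G N (2 ℕ.+ k))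
      ≈⟨ solve 6 (λ q a b x y z → q :* b :* x :+ y :+ q :* (q :* a) :* (b :* y :+ z)
                   := q :* b :* (x :+ q :* a :* y) :+ (y :+ q :* (q :* a) :* z))
           refl q (q ^ k) (q ^ d) (G N k) (G N (suc k)) (G N (2 ℕ.+ k)) ⟩
    q ^ suc d * G (suc N) (suc k) + G (suc N) (2 ℕ.+ k) ∎
    where
    N = suc (k ℕ.+ d)
    h₁ : G (suc N) (suc k) ≈ q ^ suc d * G N k + G N (suc k)
    h₁ = ≡.subst (λ M → G (suc M) (suc k) ≈ q ^ suc d * G M k + G M (suc k)) (ℕP.+-suc k d) (G-pascalʳ k (suc d))

  -- The two Pascal rules expand the same binomial; equating the expansions gives this.
  absorbʳ : ∀ k d → (1# - q ^ suc k) * G (k ℕ.+ d) (suc k) ≈ (1# - q ^ d) * G (k ℕ.+ d) k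
  absorbʳ k d = begin
    (1# - q ^ suc k) * y
      ≈⟨ solve 3 (λ a x y → (con (+ 1) :- a) :* y := x :+ y :- (x :+ a :* y)) refl (q ^ suc k) x y ⟩
    x + y - G (suc (k ℕ.+ d)) (suc k)
      ≈⟨ +-congˡ (-‿cong (G-pascalʳ k d)) ⟩
    x + y - (q ^ d * x + y)
      ≈⟨ solve 3 (λ b x y → x :+ y :- (b :* x :+ y) := (con (+ 1) :- b) :* x) refl (q ^ d) x y ⟩
    (1# - q ^ d) * x ∎
    where
    x = G (k ℕ.+ d) k
    y = G (k ℕ.+ d) (suc k)

  absorb : ∀ k d → (1# - q ^ suc k) * G (suc (k ℕ.+ d)) (suc k) ≈ (1# - q ^ suc (k ℕ.+ d)) * G (k ℕ.+ d) k
  absorb k d = begin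
    (1# - q ^ suc k) * (x + q ^ suc k * y)
      ≈⟨ solve 3 (λ a x y → (con (+ 1) :- a) :* (x :+ a :* y) := (con (+ 1) :- a) :* x :+ a :*
          ((con (+ 1) :- a) :* y)) refl (q ^ suc k) x y ⟩
    (1# - q ^ suc k) * x + q ^ suc k * ((1# - q ^ suc k) * y)
      ≈⟨ +-congˡ (*-congˡ (absorbʳ k d)) ⟩
    (1# - q ^ suc k) * x + q ^ suc k * ((1# - q ^ d) * x)
      ≈⟨ solve 3 (λ a b x → (con (+ 1) :- a) :* x :+ a :* ((con (+ 1) :- b) :* x) := (con (+ 1) :- a :* b) :* x)
          refl (q ^ suc k) (q ^ d) x ⟩
    (1# - q ^ suc k * q ^ d) * x
      ≈⟨ *-congʳ (+-congˡ (-‿cong (^-homo-* q (suc k) d))) ⟨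
    (1# - q ^ suc (k ℕ.+ d)) * x ∎
    where
    x = G (k ℕ.+ d) k
    y = G (k ℕ.+ d) (suc k)

  qfact : ℕ → Carrier
  qfact zero    = 1#
  qfact (suc m) = qfact m * (1# - q ^ suc m)

  G-qfact : ∀ k d → G (k ℕ.+ d) k * (qfact k * qfact d) ≈ qfact (k ℕ.+ d)
  G-qfact zero    d = solve 1 (λ a → con (+ 1) :* (con (+ 1) :* a) := a) refl (qfact d)
  G-qfact (suc k) d = begin
    g * (qfact k * (1# - q ^ suc k) * qfact d)
      ≈⟨ solve 4 (λ g a b c → g :* (a :* b :* c) := b :* g :* (a :* c)) refl g (qfact k) (1# - q ^ suc k) (qfact d)
          ⟩
    (1# - q ^ suc k) * g * (qfact k * qfact d)
      ≈⟨ *-congʳ (absorb k d) ⟩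
    p * G (k ℕ.+ d) k * (qfact k * qfact d)
      ≈⟨ *-assoc _ _ _ ⟩
    p * (G (k ℕ.+ d) k * (qfact k * qfact d))
      ≈⟨ *-congˡ (G-qfact k d) ⟩
    p * qfact (k ℕ.+ d)
      ≈⟨ *-comm _ _ ⟩
    qfact (k ℕ.+ d) * p ∎
    where
    g = G (suc (k ℕ.+ d)) (suc k)
    p = 1# - q ^ suc (k ℕ.+ d)

  -- The sum over all integers j = 3m + 1 of sgn(j) q^(6m² + 3m) [2n, n + j]; the indices m ≥ 0 and
  -- -(m + 1) are combined in a single term.
  partialTheta : ℕ → ℕ → Carrier
  partialTheta n m = q ^ (6 ℕ.* (m ℕ.* m) ℕ.+ 3 ℕ.* m) * G (n ℕ.+ n) (n ℕ.+ (1 ℕ.+ 3 ℕ.* m))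
                   - q ^ (6 ℕ.* (m ℕ.* m) ℕ.+ 9 ℕ.* m ℕ.+ 3) * G (n ℕ.+ n) (n ℕ.+ (2 ℕ.+ 3 ℕ.* m))

  -- What passes between neighbouring blocks of the theta sum when n grows by one. At m = 0 it is
  -- the new summand q^n [2n, n] of the central sum.
  boundary : ℕ → ℕ → Carrier
  boundary n m = q ^ (6 ℕ.* (m ℕ.* m) ℕ.+ n) * G (n ℕ.+ n) (n ℕ.+ 3 ℕ.* m)

  -- The mirror rule contains q^(N - k), which has a negative exponent for k > N. The factor q^e
  -- absorbs it into q^b, and for k > N all binomials involved vanish.
  G-pascalʳ-scaled : ∀ e {N} k {b} → e ℕ.+ N ≡ k ℕ.+ b →
    q ^ e * G (suc N) (suc k) ≈ q ^ b * G N k + q ^ e * G N (suc k)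
  G-pascalʳ-scaled e {N} k {b} eq with k ℕ.≤? N
  ... | no k≰N = begin
    q ^ e * G (suc N) (suc k)          ≈⟨ *-congˡ (G-zero (s≤s N<k)) ⟩
    q ^ e * 0#                         ≈⟨ solve 2 (λ a b → a :* con (+ 0) := b :* con (+ 0) :+ a :* con (+ 0)) refl
        (q ^ e) (q ^ b) ⟩
    q ^ b * 0# + q ^ e * 0#            ≈⟨ +-cong (*-congˡ (G-zero N<k)) (*-congˡ (G-zero (ℕP.m<n⇒m<1+n N<k))) ⟨
    q ^ b * G N k + q ^ e * G N (suc k) ∎
    where N<k = ℕP.≰⇒> k≰N
  ... | yes k≤N with ℕP.m≤n⇒∃[o]m+o≡n k≤N
  ...   | d , ≡.refl = begin
    q ^ e * G (suc (k ℕ.+ d)) (suc k)               ≈⟨ *-congˡ (G-pascalʳ k d) ⟩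
    q ^ e * (q ^ d * G (k ℕ.+ d) k + G (k ℕ.+ d) (suc k))
      ≈⟨ solve 4 (λ a b x y → a :* (b :* x :+ y) := a :* b :* x :+ a :* y) refl _ _ _ _ ⟩
    q ^ e * q ^ d * G (k ℕ.+ d) k + q ^ e * G (k ℕ.+ d) (suc k)
      ≈⟨ +-congʳ (*-congʳ (^-homo-* q e d)) ⟨
    q ^ (e ℕ.+ d) * G (k ℕ.+ d) k + q ^ e * G (k ℕ.+ d) (suc k)
      ≈⟨ +-congʳ (*-congʳ (^-congʳ q e+d≡b)) ⟩
    q ^ b * G (k ℕ.+ d) k + q ^ e * G (k ℕ.+ d) (suc k) ∎
    where
    e+d≡b : e ℕ.+ d ≡ b
    e+d≡b = ℕP.+-cancelˡ-≡ k _ _ (≡.trans (lem k e d) eq)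
      where
      lem : ∀ k e d → k ℕ.+ (e ℕ.+ d) ≡ e ℕ.+ (k ℕ.+ d)
      lem = solve-∀

  -- Each of the two binomials is expanded by both Pascal rules. The theta exponents are such that
  -- both produce [2n + 1, n + 3m + 2] with the same power `q ^ c`; these cancel, and the outermost
  -- terms are the boundaries.
  partialTheta-suc : ∀ n m → partialTheta (suc n) m ≈ partialTheta n m + (boundary n m - boundary n (suc m))
  partialTheta-suc n m = begin
    partialTheta (suc n) m
      ≈⟨ +-cong (*-congˡ (reflexive (≡.cong₂ G N″ k₁))) (-‿cong (*-congˡ (reflexive (≡.cong₂ G N″ k₂)))) ⟩
    q ^ e₁ * (G (suc N) (suc k) + q ^ (2 ℕ.+ k) * x) - q ^ e₂ * G (2 ℕ.+ N) (3 ℕ.+ k)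
      ≈⟨ +-cong (distribˡ _ _ _) (-‿cong (trans (G-pascalʳ-scaled e₂ (2 ℕ.+ k) (lem₂ n m))
          (+-congˡ (distribˡ _ _ _)))) ⟩
    q ^ e₁ * G (suc N) (suc k) + q ^ e₁ * (q ^ (2 ℕ.+ k) * x)
      - (q ^ c * x + (q ^ e₂ * G N (2 ℕ.+ k) + q ^ e₂ * (q ^ (3 ℕ.+ k) * G N (3 ℕ.+ k))))
      ≈⟨ +-cong (+-cong (G-pascalʳ-scaled e₁ k (lem₁ n m)) (pull e₁ (2 ℕ.+ k) (lem₃ n m)))
                (-‿cong (+-congˡ (+-congˡ (pull e₂ (3 ℕ.+ k) (lem₄ n m))))) ⟩
    q ^ b * G N k + q ^ e₁ * G N (suc k) + q ^ c * x
      - (q ^ c * x + (q ^ e₂ * G N (2 ℕ.+ k) + q ^ b′ * G N (3 ℕ.+ k)))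
      ≈⟨ solve 5 (λ u v w s t → u :+ v :+ w :- (w :+ (s :+ t)) := v :- s :+ (u :- t)) refl _ _ _ _ _ ⟩
    q ^ e₁ * G N (suc k) - q ^ e₂ * G N (2 ℕ.+ k) + (q ^ b * G N k - q ^ b′ * G N (3 ℕ.+ k))
      ≈⟨ +-cong (+-cong (*-congˡ (reflexive (≡.cong (G N) (≡.sym (lem₅ n m)))))
          (-‿cong (*-congˡ (reflexive (≡.cong (G N) (≡.sym (lem₆ n m)))))))
                (+-congˡ (-‿cong (*-congˡ (reflexive (≡.cong (G N) (≡.sym (lem₇ n m))))))) ⟩
    partialTheta n m + (boundary n m - boundary n (suc m)) ∎
    where
    N  = n ℕ.+ n
    k  = n ℕ.+ 3 ℕ.* m
    e₁ = 6 ℕ.* (m ℕ.* m) ℕ.+ 3 ℕ.* m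
    e₂ = 6 ℕ.* (m ℕ.* m) ℕ.+ 9 ℕ.* m ℕ.+ 3
    b  = 6 ℕ.* (m ℕ.* m) ℕ.+ n
    b′ = 6 ℕ.* (suc m ℕ.* suc m) ℕ.+ n
    c  = 6 ℕ.* (m ℕ.* m) ℕ.+ 6 ℕ.* m ℕ.+ n ℕ.+ 2
    x  = G (suc N) (2 ℕ.+ k)

    pull : ∀ s t {u y} → s ℕ.+ t ≡ u → q ^ s * (q ^ t * y) ≈ q ^ u * y
    pull s t e = trans (sym (*-assoc _ _ _)) (*-congʳ (trans (sym (^-homo-* q s t)) (^-congʳ q e)))

    lem₁ : ∀ n m → (6 ℕ.* (m ℕ.* m) ℕ.+ 3 ℕ.* m) ℕ.+ (n ℕ.+ n) ≡ (n ℕ.+ 3 ℕ.* m) ℕ.+ (6 ℕ.* (m ℕ.* m) ℕ.+ n)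
    lem₁ = solve-∀
    lem₂ : ∀ n m → (6 ℕ.* (m ℕ.* m) ℕ.+ 9 ℕ.* m ℕ.+ 3) ℕ.+ (1 ℕ.+ (n ℕ.+ n))
      ≡ (2 ℕ.+ (n ℕ.+ 3 ℕ.* m)) ℕ.+ (6 ℕ.* (m ℕ.* m) ℕ.+ 6 ℕ.* m ℕ.+ n ℕ.+ 2)
    lem₂ = solve-∀
    lem₃ : ∀ n m → (6 ℕ.* (m ℕ.* m) ℕ.+ 3 ℕ.* m) ℕ.+ (2 ℕ.+ (n ℕ.+ 3 ℕ.* m)) ≡ 6 ℕ.* (m ℕ.* m)
        ℕ.+ 6 ℕ.* m ℕ.+ n ℕ.+ 2
    lem₃ = solve-∀
    lem₄ : ∀ n m → (6 ℕ.* (m ℕ.* m) ℕ.+ 9 ℕ.* m ℕ.+ 3) ℕ.+ (3 ℕ.+ (n ℕ.+ 3 ℕ.* m)) ≡ 6 ℕ.*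
        ((1 ℕ.+ m) ℕ.* (1 ℕ.+ m)) ℕ.+ n
    lem₄ = solve-∀
    lem₅ : ∀ n m → n ℕ.+ (1 ℕ.+ 3 ℕ.* m) ≡ 1 ℕ.+ (n ℕ.+ 3 ℕ.* m)
    lem₅ = solve-∀
    lem₆ : ∀ n m → n ℕ.+ (2 ℕ.+ 3 ℕ.* m) ≡ 2 ℕ.+ (n ℕ.+ 3 ℕ.* m)
    lem₆ = solve-∀
    lem₇ : ∀ n m → n ℕ.+ 3 ℕ.* (1 ℕ.+ m) ≡ 3 ℕ.+ (n ℕ.+ 3 ℕ.* m)
    lem₇ = solve-∀
    N″ : suc n ℕ.+ suc n ≡ 2 ℕ.+ (n ℕ.+ n)
    N″ = ≡.cong suc (ℕP.+-suc n n)
    k₁ : suc n ℕ.+ (1 ℕ.+ 3 ℕ.* m) ≡ 2 ℕ.+ (n ℕ.+ 3 ℕ.* m)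
    k₁ = ≡.cong suc (lem₅ n m)
    k₂ : suc n ℕ.+ (2 ℕ.+ 3 ℕ.* m) ≡ 3 ℕ.+ (n ℕ.+ 3 ℕ.* m)
    k₂ = ≡.cong suc (lem₆ n m)

  -- Telescoping over the blocks, the step from n to n + 1 adds `boundary n 0 - boundary n M`; the
  -- first is the new summand and the second is zero as n < 3M. `M` stays free so that each residue
  -- class of n can choose where the last block lies.
  central-sum : ∀ M n → n ≤ 3 ℕ.* M →
    ∑ n (λ k → q ^ k * G (k ℕ.+ k) k) ≈ ∑ M (partialTheta n)
  central-sum M zero    _ = sym (trans (∑-cong M (λ m _ → vanish m)) (∑-0 M))
    where
    vanish : ∀ m → partialTheta 0 m ≈ 0#
    vanish m = solve 2 (λ a b → a :* con (+ 0) :- b :* con (+ 0) := con (+ 0)) refl _ _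
  central-sum M (suc n) n<3M = begin
    ∑ n (λ k → q ^ k * G (k ℕ.+ k) k) + q ^ n * G (n ℕ.+ n) n
      ≈⟨ +-cong (central-sum M n (ℕP.<⇒≤ n<3M)) first ⟩
    ∑ M (partialTheta n) + (boundary n 0 - boundary n M)
      ≈⟨ +-congˡ (∑-telescope M (boundary n)) ⟨
    ∑ M (partialTheta n) + ∑ M (λ m → boundary n m - boundary n (suc m))
      ≈⟨ ∑-+ M (partialTheta n) (λ m → boundary n m - boundary n (suc m)) ⟨
    ∑ M (λ m → partialTheta n m + (boundary n m - boundary n (suc m)))
      ≈⟨ ∑-cong M (λ m _ → partialTheta-suc n m) ⟨
    ∑ M (partialTheta (suc n)) ∎
    where
    first : q ^ n * G (n ℕ.+ n) n ≈ boundary n 0 - boundary n M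
    first = begin
      q ^ n * G (n ℕ.+ n) n                   ≡⟨ ≡.cong (λ k → q ^ n * G (n ℕ.+ n) k) (ℕP.+-identityʳ n) ⟨
      boundary n 0                            ≈⟨ solve 2 (λ a b → a := a :- b :* con (+ 0)) refl _
          (q ^ (6 ℕ.* (M ℕ.* M) ℕ.+ n)) ⟩
      boundary n 0 - q ^ (6 ℕ.* (M ℕ.* M) ℕ.+ n) * 0#
        ≈⟨ +-congˡ (-‿cong (*-congˡ (G-zero (ℕP.+-monoʳ-< n n<3M)))) ⟨
      boundary n 0 - boundary n M             ∎

-- Triangular numbers, with `tri i` = i(i - 1)/2, and parity.

tri : ℕ → ℕ
tri zero    = 0
tri (suc i) = i ℕ.+ tri i

tri-+ : ∀ i m → tri (suc m) ℕ.+ (i ℕ.+ m) ℕ.* i ≡ tri (suc (i ℕ.+ m)) ℕ.+ tri i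
tri-+ zero    m = lem (tri (suc m)) m
  where
  lem : ∀ a m → a ℕ.+ m ℕ.* 0 ≡ a ℕ.+ 0
  lem = solve-∀
tri-+ (suc i) m = ≡.trans (lem₁ (tri (suc m)) i m) (≡.trans (≡.cong (ℕ._+ (suc i ℕ.+ m ℕ.+ i)) (tri-+ i m))
    (lem₂ (tri (suc (i ℕ.+ m))) (tri i) i m))
  where
  lem₁ : ∀ a i m → a ℕ.+ (1 ℕ.+ i ℕ.+ m) ℕ.* (1 ℕ.+ i) ≡ a ℕ.+ (i ℕ.+ m) ℕ.* i ℕ.+ (1 ℕ.+ i ℕ.+ m ℕ.+ i)
  lem₁ = solve-∀
  lem₂ : ∀ a b i m → a ℕ.+ b ℕ.+ (1 ℕ.+ i ℕ.+ m ℕ.+ i) ≡ 1 ℕ.+ (i ℕ.+ m) ℕ.+ a ℕ.+ (i ℕ.+ b)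
  lem₂ = solve-∀

-- With i = r - m, `tri-+` reads tri (m + 1) + r i = tri (r + 1) + tri i. This is its counterpart
-- for -(m + 1) in place of m, which has the same triangular number m(m + 1)/2.
tri-reflect : ∀ r m → tri (suc m) ℕ.+ r ℕ.* suc (r ℕ.+ m) ≡ tri (suc r) ℕ.+ tri (suc (r ℕ.+ m))
tri-reflect r m = ≡.trans (lem₁ (tri (suc m)) r m)
  (≡.trans (≡.cong (ℕ._+ r) (tri-+ r m)) (lem₂ (tri (suc (r ℕ.+ m))) (tri r) r))
  where
  lem₁ : ∀ a r m → a ℕ.+ r ℕ.* (1 ℕ.+ (r ℕ.+ m)) ≡ a ℕ.+ (r ℕ.+ m) ℕ.* r ℕ.+ r
  lem₁ = solve-∀
  lem₂ : ∀ a b r → a ℕ.+ b ℕ.+ r ≡ r ℕ.+ b ℕ.+ a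
  lem₂ = solve-∀

2*tri : ∀ i → 2 ℕ.* tri (suc i) ≡ suc i ℕ.* i
2*tri zero    = ≡.refl
2*tri (suc i) = ≡.trans (lem₁ (tri (suc i)) i) (≡.trans (≡.cong (λ k → 2 ℕ.* suc i ℕ.+ k) (2*tri i)) (lem₂ i))
  where
  lem₁ : ∀ a i → 2 ℕ.* (1 ℕ.+ i ℕ.+ a) ≡ 2 ℕ.* (1 ℕ.+ i) ℕ.+ 2 ℕ.* a
  lem₁ = solve-∀
  lem₂ : ∀ i → 2 ℕ.* (1 ℕ.+ i) ℕ.+ (1 ℕ.+ i) ℕ.* i ≡ (2 ℕ.+ i) ℕ.* (1 ℕ.+ i)
  lem₂ = solve-∀

parity : ∀ n → ∃ λ u → n ≡ u ℕ.+ u ⊎ n ≡ suc (u ℕ.+ u)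
parity zero    = 0 , inj₁ ≡.refl
parity (suc n) with parity n
... | u , inj₁ e = u , inj₂ (≡.cong suc e)
... | u , inj₂ e = suc u , inj₁ (≡.cong suc (≡.trans e (≡.sym (ℕP.+-suc u u))))


-- Roots of unity with cancellable 1 - q^k, and the inverses of 1 - t.

record RegularRoot (R : CommutativeRing 0ℓ 0ℓ) (n : ℕ) (q : CommutativeRing.Carrier R) : Set where
  open Arithmetic R
  field
    q^n≈1     : q ^ n ≈ 1#
    -- Primitivity as a cancellation law for 1 - q^k, phrased through fixed elements so that a gcd
    -- argument on exponents can prove it.
    q-regular : ∀ k → n ∤ k → ∀ {a} → q ^ k * a ≈ a → a ≈ 0#

module RootOfUnity
  (R : CommutativeRing 0ℓ 0ℓ) (n′ : ℕ) (q : CommutativeRing.Carrier R)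
  (root : RegularRoot R (suc n′) q) where
  open Arithmetic R
  open RegularRoot root

  n = suc n′
  N = n ·1

  Regular : Carrier → Set
  Regular t = ∀ {a} → t * a ≈ a → a ≈ 0#

  -- V t is n / (1 - t) for every n-th root of unity t with 1 - t regular.
  V : Carrier → Carrier
  V t = ∑ n (λ s → [ s ] t)

  V-cong : ∀ {t t′} → t ≈ t′ → V t ≈ V t′
  V-cong h = ∑-cong n (λ s _ → ∑-cong s (λ u _ → ^-congˡ u h))

  cancel : ∀ {t a} → Regular t → (1# - t) * a ≈ 0# → a ≈ 0#
  cancel {t} {a} reg h = reg (sym (x-y≈0⇒x≈y (trans
    (solve 2 (λ t a → a :- t :* a := (con (+ 1) :- t) :* a) refl t a) h)))

  -- Multiplying the geometric sums by 1 - t turns `V t` into the sum of 1 - t^s over s < n, and the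
  -- full sum of the t^s vanishes because 1 - t annihilates it.
  V-inverse : ∀ {t} → t ^ n ≈ 1# → Regular t → (1# - t) * V t ≈ N
  V-inverse {t} t^n≈1 reg = begin
    (1# - t) * V t                        ≈⟨ ∑-* n (1# - t) (λ s → [ s ] t) ⟨
    ∑ n (λ s → (1# - t) * [ s ] t)        ≈⟨ ∑-cong n (λ s _ → trans (geometric s t) (lem s)) ⟩
    ∑ n (λ s → 1# + (- 1#) * t ^ s)       ≈⟨ ∑-+ n (λ _ → 1#) (λ s → (- 1#) * t ^ s) ⟩
    N + ∑ n (λ s → (- 1#) * t ^ s)        ≈⟨ +-congˡ (∑-* n (- 1#) (t ^_)) ⟩
    N + (- 1#) * [ n ] t                  ≈⟨ +-congˡ (*-congˡ [n]≈0) ⟩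
    N + (- 1#) * 0#                       ≈⟨ solve 1 (λ a → a :+ (:- con (+ 1)) :* con (+ 0) := a) refl N ⟩
    N                                     ∎
    where
    lem : ∀ s → 1# - t ^ s ≈ 1# + (- 1#) * t ^ s
    lem s = solve 1 (λ a → con (+ 1) :- a := con (+ 1) :+ (:- con (+ 1)) :* a) refl (t ^ s)
    [n]≈0 : [ n ] t ≈ 0#
    [n]≈0 = cancel reg (trans (geometric n t) (trans (+-congˡ (-‿cong t^n≈1)) (-‿inverseʳ 1#)))

  t*V : ∀ {t} → t ^ n ≈ 1# → Regular t → t * V t ≈ V t - N
  t*V {t} t^n≈1 reg = trans
    (solve 2 (λ t v → t :* v := v :- (con (+ 1) :- t) :* v) refl t (V t))
    (+-congˡ (-‿cong (V-inverse t^n≈1 reg)))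

  module _ {t t′ : Carrier} (tt′≈1 : t * t′ ≈ 1#) where
    inverse-^n : t ^ n ≈ 1# → t′ ^ n ≈ 1#
    inverse-^n h = begin
      t′ ^ n             ≈⟨ *-identityˡ _ ⟨
      1# * t′ ^ n        ≈⟨ *-congʳ h ⟨
      t ^ n * t′ ^ n     ≈⟨ ^-distrib-* t t′ n ⟨
      (t * t′) ^ n       ≈⟨ ^-≡1 n tt′≈1 ⟩
      1#                 ∎

    inverse-regular : Regular t → Regular t′
    inverse-regular reg {a} h = reg (begin
      t * a              ≈⟨ *-congˡ h ⟨
      t * (t′ * a)       ≈⟨ *-assoc _ _ _ ⟨
      t * t′ * a         ≈⟨ *-congʳ tt′≈1 ⟩
      1# * a             ≈⟨ *-identityˡ a ⟩
      a                  ∎)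

    -- The identity t/(1 - t) = -1/(1 - 1/t), checked after multiplication by the regular element 1
    -- - t.
    V-inverse-root : t ^ n ≈ 1# → Regular t → t * V t ≈ - V t′
    V-inverse-root t^n≈1 reg = x-y≈0⇒x≈y (cancel reg (begin
      (1# - t) * (t * V t - - V t′)
        ≈⟨ solve 4 (λ t t′ v v′ → (con (+ 1) :- t) :* (t :* v :- :- v′)
             := t :* ((con (+ 1) :- t) :* v) :- t :* ((con (+ 1) :- t′) :* v′) :+ (con (+ 1) :- t :* t′) :* v′)
             refl t t′ (V t) (V t′) ⟩
      t * ((1# - t) * V t) - t * ((1# - t′) * V t′) + (1# - t * t′) * V t′
        ≈⟨ +-cong (+-cong (*-congˡ (V-inverse t^n≈1 reg)) (-‿cong
            (*-congˡ (V-inverse (inverse-^n t^n≈1) (inverse-regular reg)))))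
                  (*-congʳ (+-congˡ (-‿cong tt′≈1))) ⟩
      t * N - t * N + (1# - 1#) * V t′
        ≈⟨ solve 2 (λ a v → a :- a :+ (con (+ 1) :- con (+ 1)) :* v := con (+ 0)) refl (t * N) (V t′) ⟩
      0# ∎))

  inverse-unique : ∀ {a b c} → a * c ≈ 1# → b * c ≈ 1# → a ≈ b
  inverse-unique {a} {b} {c} ac bc = begin
    a              ≈⟨ *-identityʳ a ⟨
    a * 1#         ≈⟨ *-congˡ bc ⟨
    a * (b * c)    ≈⟨ solve 3 (λ a b c → a :* (b :* c) := b :* (a :* c)) refl a b c ⟩
    b * (a * c)    ≈⟨ *-congˡ ac ⟩
    b * 1#         ≈⟨ *-identityʳ b ⟩
    b              ∎

  q^[n*k]≈1 : ∀ k → q ^ (n ℕ.* k) ≈ 1#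
  q^[n*k]≈1 k = trans (sym (^-assocʳ q n k)) (^-≡1 k q^n≈1)

  q^-^n : ∀ k → (q ^ k) ^ n ≈ 1#
  q^-^n k = trans (^-assocʳ q k n) (trans (^-congʳ q (ℕP.*-comm k n)) (q^[n*k]≈1 k))

  q^-regular : ∀ k → 0 < k → k < n → Regular (q ^ k)
  q^-regular (suc k) _ k<n = q-regular (suc k) (>⇒∤ k<n)

  -- For even n this says q^(n/2) = -1.
  q^half : ∀ k {h} → n ℕ.* k ≡ 2 ℕ.* h → q ^ h ≈ (- 1#) ^ k
  q^half k {h} e with parity n
  q^half k {h} e | u , inj₁ n≡2u = begin
    q ^ h             ≈⟨ ^-congʳ q h≡u*k ⟩
    q ^ (u ℕ.* k)     ≈⟨ ^-assocʳ q u k ⟨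
    (q ^ u) ^ k       ≈⟨ ^-congˡ k (x-y≈0⇒x≈y (q^-regular u 0<u u<n fixed)) ⟩
    (- 1#) ^ k        ∎
    where
    h≡u*k : h ≡ u ℕ.* k
    h≡u*k = ℕP.*-cancelˡ-≡ h (u ℕ.* k) 2 (≡.trans (≡.sym e) (≡.trans (≡.cong (ℕ._* k) n≡2u) (lem u k)))
      where
      lem : ∀ u k → (u ℕ.+ u) ℕ.* k ≡ 2 ℕ.* (u ℕ.* k)
      lem = solve-∀
    0<u : 0 < u
    0<u = positive u n≡2u
      where
      positive : ∀ u → n ≡ u ℕ.+ u → 0 < u
      positive (suc u) _ = s≤s z≤n
    u<n : u < n
    u<n = ≡.subst (u <_) (≡.sym n≡2u) (ℕP.m<m+n u 0<u)
    -- As q^u squares to 1, it fixes q^u + 1; regularity of q^u forces that element to be zero.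
    fixed : q ^ u * (q ^ u - - 1#) ≈ q ^ u - - 1#
    fixed = begin
      q ^ u * (q ^ u - - 1#)    ≈⟨ solve 1 (λ a → a :* (a :- :- con (+ 1)) := a :* a :+ a) refl (q ^ u) ⟩
      q ^ u * q ^ u + q ^ u     ≈⟨ +-congʳ (trans (sym (^-homo-* q u u)) (trans (^-congʳ q (≡.sym n≡2u)) q^n≈1)) ⟩
      1# + q ^ u                ≈⟨ solve 1 (λ a → con (+ 1) :+ a := a :- :- con (+ 1)) refl (q ^ u) ⟩
      q ^ u - - 1#              ∎
  q^half k {h} e | u , inj₂ n≡1+2u with parity k
  q^half k {h} e | u , inj₂ n≡1+2u | v , inj₁ k≡2v = begin
    q ^ h                 ≈⟨ ^-congʳ q h≡n*v ⟩
    q ^ (n ℕ.* v)         ≈⟨ q^[n*k]≈1 v ⟩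
    1#                    ≈⟨ ^-≡1 v (solve 0 ((:- con (+ 1)) :* ((:- con (+ 1)) :* con (+ 1)) := con (+ 1)) refl) ⟨
    ((- 1#) ^ 2) ^ v      ≈⟨ ^-assocʳ (- 1#) 2 v ⟩
    (- 1#) ^ (2 ℕ.* v)    ≈⟨ ^-congʳ (- 1#) (≡.trans (≡.cong (v ℕ.+_) (ℕP.+-identityʳ v)) (≡.sym k≡2v)) ⟩
    (- 1#) ^ k            ∎
    where
    h≡n*v : h ≡ n ℕ.* v
    h≡n*v = ℕP.*-cancelˡ-≡ h (n ℕ.* v) 2 (≡.trans (≡.sym e) (≡.trans (≡.cong (n ℕ.*_) k≡2v) (lem n v)))
      where
      lem : ∀ u k → u ℕ.* (k ℕ.+ k) ≡ 2 ℕ.* (u ℕ.* k)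
      lem = solve-∀
  q^half k {h} e | u , inj₂ n≡1+2u | v , inj₂ k≡1+2v =
    contradiction (≡.trans (≡.sym (lem u v)) (≡.trans (≡.cong₂ ℕ._*_ (≡.sym n≡1+2u) (≡.sym k≡1+2v)) e))
        (ℕP.even≢odd h (u ℕ.+ v ℕ.+ 2 ℕ.* (u ℕ.* v)) ∘ ≡.sym)
    where
    lem : ∀ u v → (1 ℕ.+ (u ℕ.+ u)) ℕ.* (1 ℕ.+ (v ℕ.+ v)) ≡ 1 ℕ.+ 2 ℕ.* (u ℕ.+ v ℕ.+ 2 ℕ.* (u ℕ.* v))
    lem = solve-∀

  -- The Appell sum and its recurrence.

  y x : Carrier
  y = q ^ 3
  -- The inverse of `y`, as y^n = 1; it carries the negative powers of q.
  x = y ^ n′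

  xy≈1 : x * y ≈ 1#
  xy≈1 = trans (*-comm x y) (trans (^-assocʳ q 3 n) (trans (^-congʳ q (ℕP.*-comm 3 n)) (q^[n*k]≈1 3)))

  x^y^ : ∀ k → x ^ k * y ^ k ≈ 1#
  x^y^ k = trans (sym (^-distrib-* x y k)) (^-≡1 k xy≈1)

  x^n≈1 : ∀ k → (x ^ k) ^ n ≈ 1#
  x^n≈1 k = inverse-^n (trans (*-comm _ _) (x^y^ k))
    (trans (^-congˡ n (^-assocʳ q 3 k)) (q^-^n (3 ℕ.* k)))

  -- The coefficient (-1)^m q^(3m(m+1)/2) that stands at 1/(1 - q^(3m+1)) once the powers of q in
  -- the identity and in the binomial are combined.
  κ : ℕ → Carrier
  κ m = (- 1#) ^ m * y ^ tri (suc m)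

  c : ℕ → ℕ → Carrier
  c s i = (- 1#) ^ i * x ^ (s ℕ.* i) * y ^ tri i

  U L : ℕ → Carrier
  U i = V (x ^ i)
  L i = x ^ i * U i

  c-zero : ∀ s → c s 0 ≈ 1#
  c-zero s = trans (*-congʳ (*-congˡ (^-congʳ x (ℕP.*-zeroʳ s))))
    (solve 0 (con (+ 1) :* con (+ 1) :* con (+ 1) := con (+ 1)) refl)

  c-scale : ∀ s i → c (suc s) i ≈ c s i * x ^ i
  c-scale s i = trans (*-congʳ (*-congˡ (^-homo-* x i (s ℕ.* i))))
    (solve 4 (λ e a b t → e :* (a :* b) :* t := e :* b :* t :* a) refl _ (x ^ i) _ _)

  c-suc : ∀ s i → c s (suc i) ≈ - (x ^ s * y ^ i * c s i)
  c-suc s i = trans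
    (*-cong (*-congˡ (trans (^-congʳ x (ℕP.*-suc s i)) (^-homo-* x s (s ℕ.* i)))) (^-homo-* y i (tri i)))
    (solve 5 (λ e a b u t → (:- con (+ 1) :* e) :* (a :* b) :* (u :* t) := :- (a :* u :* (e :* b :* t)))
      refl ((- 1#) ^ i) (x ^ s) (x ^ (s ℕ.* i)) (y ^ i) (y ^ tri i))

  -- In total, x occurs in `c s i` with exponent i(2s + 1 - i)/2; raising both s and i by one adds s
  -- + 1 to it and flips the sign.
  c-shift : ∀ s i → c (suc s) (suc i) ≈ - (x ^ suc s * c s i)
  c-shift s i = begin
    c (suc s) (suc i)                               ≈⟨ c-suc (suc s) i ⟩
    - (x ^ suc s * y ^ i * c (suc s) i)             ≈⟨ -‿cong (*-congˡ (c-scale s i)) ⟩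
    - (x ^ suc s * y ^ i * (c s i * x ^ i))
      ≈⟨ solve 4 (λ a u d b → :- (a :* u :* (d :* b)) := :- (b :* u :* (a :* d))) refl _ _ _ _ ⟩
    - (x ^ i * y ^ i * (x ^ suc s * c s i))         ≈⟨ -‿cong (trans (*-congʳ (x^y^ i)) (*-identityˡ _)) ⟩
    - (x ^ suc s * c s i)                           ∎

  c-last : ∀ s → c s (suc (s ℕ.+ s)) ≈ - 1#
  c-last zero = solve 0 (((:- con (+ 1)) :* con (+ 1)) :* con (+ 1) :* con (+ 1) := :- con (+ 1)) refl
  c-last (suc s) = begin
    c (suc s) (suc (suc s ℕ.+ suc s))           ≈⟨ c-shift s (suc s ℕ.+ suc s) ⟩
    - (x ^ suc s * c s (suc s ℕ.+ suc s))       ≡⟨ ≡.cong (λ k → - (x ^ suc s * c s k)) (≡.cong suc (ℕP.+-suc s s))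
        ⟩
    - (x ^ suc s * c s (2 ℕ.+ (s ℕ.+ s)))       ≈⟨ -‿cong (*-congˡ
        (trans (c-suc s (suc (s ℕ.+ s))) (-‿cong (*-congˡ (c-last s))))) ⟩
    - (x ^ suc s * - (x ^ s * y ^ suc (s ℕ.+ s) * - 1#))
      ≈⟨ solve 3 (λ a b d → :- (a :* :- (b :* d :* :- con (+ 1))) := :- (a :* b :* d)) refl _ _ _ ⟩
    - (x ^ suc s * x ^ s * y ^ suc (s ℕ.+ s))   ≈⟨ -‿cong (*-congʳ (^-homo-* x (suc s) s)) ⟨
    - (x ^ suc (s ℕ.+ s) * y ^ suc (s ℕ.+ s))   ≈⟨ -‿cong (x^y^ (suc (s ℕ.+ s))) ⟩
    - 1#                                        ∎

  -- The exponent i(2s + 1 - i)/2 is symmetric under i ↦ 2s + 1 - i while the sign changes. The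
  -- induction uses `c-shift`: the shifted sum gains the end terms 1 and -1, which cancel.
  c-sum : ∀ s → ∑ (s ℕ.+ s) (λ i → c s (suc i)) ≈ 0#
  c-sum zero = refl
  c-sum (suc s) = begin
    ∑ (suc s ℕ.+ suc s) (λ i → c (suc s) (suc i))
      ≈⟨ ∑-cong (suc s ℕ.+ suc s) (λ i _ → trans (c-shift s i)
          (solve 2 (λ a b → :- (a :* b) := (:- a) :* b) refl _ _)) ⟩
    ∑ (suc s ℕ.+ suc s) (λ i → (- x ^ suc s) * c s i)
      ≈⟨ ∑-* (suc s ℕ.+ suc s) (- x ^ suc s) (c s) ⟩
    (- x ^ suc s) * ∑ (suc s ℕ.+ suc s) (c s)
      ≡⟨ ≡.cong (λ k → (- x ^ suc s) * ∑ k (c s)) (≡.cong suc (ℕP.+-suc s s)) ⟩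
    (- x ^ suc s) * ∑ (2 ℕ.+ (s ℕ.+ s)) (c s)
      ≈⟨ *-congˡ (trans (∑-head (suc (s ℕ.+ s)) (c s)) (+-cong (c-zero s) (+-cong (c-sum s) (c-last s)))) ⟩
    (- x ^ suc s) * (1# + (0# + - 1#))
      ≈⟨ solve 1 (λ a → a :* (con (+ 1) :+ (con (+ 0) :+ :- con (+ 1))) := con (+ 0)) refl _ ⟩
    0# ∎

  -- The Appell sum Σ (-1)^i x^(si - i(i-1)/2) / (1 - x^i) over 1 ≤ i ≤ M, multiplied by n.
  F : ℕ → ℕ → Carrier
  F s M = ∑ M (λ i → c s (suc i) * U (suc i))

  module Coprime-3 (coprime : ∀ i → n ∣ 3 ℕ.* i → n ∣ i) where

    x-regular : ∀ i → 0 < i → i < n → Regular (x ^ i)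
    x-regular (suc i) _ i<n = inverse-regular (trans (*-comm _ _) (x^y^ (suc i)))
      (λ h → q-regular (3 ℕ.* suc i) (>⇒∤ i<n ∘ coprime (suc i)) (trans (*-congʳ (sym (^-assocʳ q 3 (suc i)))) h))

    L≈U-N : ∀ i → 0 < i → i < n → L i ≈ U i - N
    L≈U-N i 0<i i<n = t*V (x^n≈1 i) (x-regular i 0<i i<n)

    -- Raising s multiplies each coefficient by x^i, and x^i U_i = U_i - N. The correction is -N
    -- times a sum of coefficients that equals -1; together with the last term -U it forms -L.
    F-odd : ∀ s → suc (s ℕ.+ s) < n → F (suc s) (suc (s ℕ.+ s)) ≈ F s (s ℕ.+ s) - L (suc (s ℕ.+ s))
    F-odd s M<n = begin
      F (suc s) M
        ≈⟨ ∑-cong M (λ i i<M → trans (*-congʳ (c-scale s (suc i))) (trans (*-assoc _ _ _)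
             (trans (*-congˡ (L≈U-N (suc i) (s≤s z≤n) (ℕP.≤-<-trans i<M M<n)))
               (solve 3 (λ a u m → a :* (u :- m) := a :* u :+ (:- m) :* a) refl _ _ _)))) ⟩
      ∑ M (λ i → c s (suc i) * U (suc i) + (- N) * c s (suc i))
        ≈⟨ trans (∑-+ M _ _) (+-congˡ (∑-* M (- N) _)) ⟩
      F s M + (- N) * ∑ M (λ i → c s (suc i))
        ≈⟨ +-cong (+-congˡ (*-congʳ (c-last s))) (*-congˡ (+-cong (c-sum s) (c-last s))) ⟩
      F s (s ℕ.+ s) + (- 1#) * U M + (- N) * (0# + - 1#)
        ≈⟨ solve 3 (λ f u m → f :+ (:- con (+ 1)) :* u :+ (:- m) :* (con (+ 0) :+ :- con (+ 1)) := f :- (u :- m))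
            refl _ _ _ ⟩
      F s (s ℕ.+ s) - (U M - N)
        ≈⟨ +-congˡ (-‿cong (L≈U-N M (s≤s z≤n) M<n)) ⟨
      F s (s ℕ.+ s) - L M ∎
      where M = suc (s ℕ.+ s)

    -- Partial fractions with z = x^t: z/(1 - z²) = z/(1 - z) - z²/(1 - z²).
    half-L : ∀ t → 0 < t → t ℕ.+ t < n → x ^ t * U (t ℕ.+ t) ≈ L t - L (t ℕ.+ t)
    half-L t 0<t 2t<n = x-y≈0⇒x≈y (cancel (x-regular (t ℕ.+ t) 0<2t 2t<n) (begin
      (1# - x ^ (t ℕ.+ t)) * (a * u₂ - (a * u - b * u₂))
        ≈⟨ *-congʳ (+-congˡ (-‿cong (^-homo-* x t t))) ⟩
      (1# - a * a) * (a * u₂ - (a * u - b * u₂))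
        ≈⟨ *-congˡ (+-congˡ (-‿cong (+-congˡ (-‿cong (*-congʳ (^-homo-* x t t)))))) ⟩
      (1# - a * a) * (a * u₂ - (a * u - a * a * u₂))
        ≈⟨ solve 3 (λ a u v → (con (+ 1) :- a :* a) :* (a :* v :- (a :* u :- a :* a :* v))
              := (a :+ a :* a) :* ((con (+ 1) :- a :* a) :* v) :- (a :+ a :* a) :* ((con (+ 1) :- a) :* u))
                  refl a u u₂ ⟩
      (a + a * a) * ((1# - a * a) * u₂) - (a + a * a) * ((1# - a) * u)
        ≈⟨ +-cong (*-congˡ (trans (*-congʳ (+-congˡ (-‿cong (sym (^-homo-* x t t)))))
            (V-inverse (x^n≈1 (t ℕ.+ t)) (x-regular (t ℕ.+ t) 0<2t 2t<n))))
                  (-‿cong (*-congˡ (V-inverse (x^n≈1 t) (x-regular t 0<t (ℕP.≤-<-trans (ℕP.m≤m+n t t) 2t<n))))) ⟩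
      (a + a * a) * N - (a + a * a) * N
        ≈⟨ -‿inverseʳ _ ⟩
      0# ∎))
      where
      a  = x ^ t
      b  = x ^ (t ℕ.+ t)
      u  = U t
      u₂ = U (t ℕ.+ t)
      0<2t : 0 < t ℕ.+ t
      0<2t = ℕP.<-≤-trans 0<t (ℕP.m≤m+n t t)

    -- The one added term has coefficient x^(s+1), half the power in its denominator, so `half-L`
    -- applies.
    F-even : ∀ s → suc s ℕ.+ suc s < n → F (suc s) (suc s ℕ.+ suc s) ≈ F (suc s) (suc (s ℕ.+ s)) +
        (L (suc s) - L (suc s ℕ.+ suc s))
    F-even s M<n = begin
      F (suc s) (suc s ℕ.+ suc s)
        ≡⟨ ≡.cong (F (suc s)) 2+2s ⟩
      F (suc s) (suc (s ℕ.+ s)) + c (suc s) (2 ℕ.+ (s ℕ.+ s)) * U (2 ℕ.+ (s ℕ.+ s))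
        ≈⟨ +-congˡ (*-cong (trans (c-shift s (suc (s ℕ.+ s))) (-‿cong (*-congˡ (c-last s))))
            (reflexive (≡.cong U (≡.sym 2+2s)))) ⟩
      F (suc s) (suc (s ℕ.+ s)) + (- (x ^ suc s * - 1#)) * U (suc s ℕ.+ suc s)
        ≈⟨ +-congˡ (*-congʳ (solve 1 (λ a → :- (a :* :- con (+ 1)) := a) refl _)) ⟩
      F (suc s) (suc (s ℕ.+ s)) + x ^ suc s * U (suc s ℕ.+ suc s)
        ≈⟨ +-congˡ (half-L (suc s) (s≤s z≤n) M<n) ⟩
      F (suc s) (suc (s ℕ.+ s)) + (L (suc s) - L (suc s ℕ.+ suc s)) ∎
      where
      2+2s : suc s ℕ.+ suc s ≡ 2 ℕ.+ (s ℕ.+ s)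
      2+2s = ≡.cong suc (ℕP.+-suc s s)

    F-Lambert : ∀ s → s ℕ.+ s < n → F s (s ℕ.+ s) ≈ ∑ s (λ u → L (suc u)) - ∑ (s ℕ.+ s) (λ u → L (suc u))
    F-Lambert zero    _ = sym (-‿inverseʳ 0#)
    F-Lambert (suc s) M<n = begin
      F (suc s) (suc s ℕ.+ suc s)
        ≈⟨ trans (F-even s M<n) (+-congʳ (trans (F-odd s 1+2s<n) (+-congʳ (F-Lambert s (ℕP.<⇒≤ 1+2s<n))))) ⟩
      ∑ s l - ∑ (s ℕ.+ s) l - L (suc (s ℕ.+ s)) + (L (suc s) - L (suc s ℕ.+ suc s))
        ≈⟨ solve 5 (λ a b p r t → a :- b :- p :+ (r :- t) := a :+ r :- (b :+ p :+ t)) refl _ _ _ _ _ ⟩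
      ∑ (suc s) l - (∑ (suc (s ℕ.+ s)) l + L (suc s ℕ.+ suc s))
        ≡⟨ ≡.cong (λ k → ∑ (suc s) l - (∑ (suc (s ℕ.+ s)) l + L k)) 2+2s ⟩
      ∑ (suc s) l - ∑ (2 ℕ.+ (s ℕ.+ s)) l
        ≡⟨ ≡.cong (λ k → ∑ (suc s) l - ∑ k l) 2+2s ⟨
      ∑ (suc s) l - ∑ (suc s ℕ.+ suc s) l ∎
      where
      l : ℕ → Carrier
      l u = L (suc u)
      2+2s : suc s ℕ.+ suc s ≡ 2 ℕ.+ (s ℕ.+ s)
      2+2s = ≡.cong suc (ℕP.+-suc s s)
      1+2s<n : suc (s ℕ.+ s) < n
      1+2s<n = ℕP.<⇒≤ (≡.subst (_< n) 2+2s M<n)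

    F-closed : ∀ s → s ℕ.+ s < n → F s (s ℕ.+ s) ≈ - ∑ s (λ u → L (suc (s ℕ.+ u)))
    F-closed s M<n = trans (F-Lambert s M<n) (trans (+-congˡ (-‿cong (∑-split s s (λ u → L (suc u)))))
      (solve 2 (λ a b → a :- (a :+ b) := :- b) refl _ _))

    F-closed-odd : ∀ s → suc (s ℕ.+ s) < n → F (suc s) (suc (s ℕ.+ s)) ≈ - ∑ (suc s) (λ u → L (suc (s ℕ.+ u)))
    F-closed-odd s M<n = trans (F-odd s M<n) (trans (+-congʳ (F-closed s (ℕP.<⇒≤ M<n)))
      (solve 2 (λ a b → :- a :- b := :- (a :+ b)) refl _ _))

    L-reflect : ∀ i j → 0 < i → 0 < j → i ℕ.+ j ≡ n → L i + L j ≈ - N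
    L-reflect i j 0<i 0<j i+j≡n = begin
      L i + L j         ≈⟨ +-cong (V-inverse-root x^i*x^j≈1 (x^n≈1 i) (x-regular i 0<i i<n)) (L≈U-N j 0<j j<n) ⟩
      - U j + (U j - N) ≈⟨ solve 2 (λ u m → :- u :+ (u :- m) := :- m) refl _ _ ⟩
      - N               ∎
      where
      i<n : i < n
      i<n = ≡.subst (i <_) i+j≡n (ℕP.m<m+n i 0<j)
      j<n : j < n
      j<n = ≡.subst (j <_) i+j≡n (ℕP.m<n+m j 0<i)
      x^i*x^j≈1 : x ^ i * x ^ j ≈ 1#
      x^i*x^j≈1 = trans (sym (^-homo-* x i j)) (trans (^-congʳ x i+j≡n)
        (trans (^-congˡ n (sym (*-identityʳ x))) (x^n≈1 1)))

    -- The hypothesis says that u ↦ n - u maps the interval from r + 1 to r + M to itself. The sum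
    -- is added to its own reversal, which also covers a fixed midpoint.
    L-sum : ∀ r M → suc (r ℕ.+ r ℕ.+ M) ≡ n → let S = ∑ M (λ u → L (suc (r ℕ.+ u))) in S + S ≈ - (M ·1 * N)
    L-sum r M e = begin
      S + S
        ≈⟨ +-congˡ (∑-reverse M {g = λ u → - N - L (suc (r ℕ.+ u))} (λ i j 1+i+j≡M → reflected i j 1+i+j≡M)) ⟩
      S + ∑ M (λ u → - N - L (suc (r ℕ.+ u)))
        ≈⟨ ∑-+ M _ _ ⟨
      ∑ M (λ u → L (suc (r ℕ.+ u)) + (- N - L (suc (r ℕ.+ u))))
        ≈⟨ ∑-cong M (λ u _ → solve 2 (λ l m → l :+ (:- m :- l) := (:- m) :* con (+ 1)) refl _ _) ⟩
      ∑ M (λ u → (- N) * 1#)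
        ≈⟨ ∑-* M (- N) (λ _ → 1#) ⟩
      (- N) * M ·1
        ≈⟨ solve 2 (λ a b → (:- a) :* b := :- (b :* a)) refl _ _ ⟩
      - (M ·1 * N) ∎
      where
      S = ∑ M (λ u → L (suc (r ℕ.+ u)))
      reflected : ∀ i j → suc (i ℕ.+ j) ≡ M → L (suc (r ℕ.+ i)) ≈ - N - L (suc (r ℕ.+ j))
      reflected i j ≡.refl = trans (solve 2 (λ a b → a := a :+ b :- b) refl _ _)
        (+-congʳ (L-reflect (suc (r ℕ.+ i)) (suc (r ℕ.+ j)) (s≤s z≤n) (s≤s z≤n) (≡.trans (lem r i j) e)))
        where
        lem : ∀ r i j → (1 ℕ.+ (r ℕ.+ i)) ℕ.+ (1 ℕ.+ (r ℕ.+ j)) ≡ 1 ℕ.+ (r ℕ.+ r ℕ.+ (1 ℕ.+ (i ℕ.+ j)))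
        lem = solve-∀

  -- Reindexing the terms of the identity as an Appell sum.

  -1^[2*k] : ∀ k → (- 1#) ^ (2 ℕ.* k) ≈ 1#
  -1^[2*k] k = trans (sym (^-assocʳ (- 1#) 2 k))
    (^-≡1 k (solve 0 ((:- con (+ 1)) :* ((:- con (+ 1)) :* con (+ 1)) := con (+ 1)) refl))

  -- The first equation lets x^(ri) cancel against y^(ri), leaving the power of y in `κ m`; the
  -- second keeps track of the signs. It is applied with i = r - m and i = r + m + 1.
  κ*c : ∀ r i m e → tri (suc m) ℕ.+ r ℕ.* i ≡ tri (suc r) ℕ.+ tri i → r ℕ.+ i ≡ e ℕ.+ m →
    κ r * c r i ≈ (- 1#) ^ e * κ m
  κ*c r i m e eq₁ eq₂ = begin
    s r * y ^ tri (suc r) * (s i * x ^ (r ℕ.* i) * y ^ tri i)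
      ≈⟨ solve 5 (λ a b c d e → a :* b :* (c :* d :* e) := (a :* c) :* (d :* (b :* e))) refl _ _ _ _ _ ⟩
    s r * s i * (x ^ (r ℕ.* i) * (y ^ tri (suc r) * y ^ tri i))
      ≈⟨ *-cong (trans (sym (^-homo-* (- 1#) r i)) (trans (^-congʳ (- 1#) eq₂) (^-homo-* (- 1#) e m)))
                (*-congˡ (trans (sym (^-homo-* y (tri (suc r)) (tri i)))
                    (trans (^-congʳ y (≡.sym eq₁)) (^-homo-* y (tri (suc m)) (r ℕ.* i))))) ⟩
    s e * s m * (x ^ (r ℕ.* i) * (y ^ tri (suc m) * y ^ (r ℕ.* i)))
      ≈⟨ solve 5 (λ a b c d e → a :* b :* (c :* (d :* e)) := a :* (b :* d) :* (c :* e)) refl _ _ _ _ _ ⟩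
    s e * κ m * (x ^ (r ℕ.* i) * y ^ (r ℕ.* i))
      ≈⟨ trans (*-congˡ (x^y^ (r ℕ.* i))) (*-identityʳ _) ⟩
    s e * κ m ∎
    where
    s : ℕ → Carrier
    s = (- 1#) ^_

  κ*c-low : ∀ i m → κ (i ℕ.+ m) * c (i ℕ.+ m) i ≈ κ m
  κ*c-low i m = trans (κ*c (i ℕ.+ m) i m (2 ℕ.* i) (tri-+ i m) (lem i m))
    (trans (*-congʳ (-1^[2*k] i)) (*-identityˡ _))
    where
    lem : ∀ i m → i ℕ.+ m ℕ.+ i ≡ 2 ℕ.* i ℕ.+ m
    lem = solve-∀

  κ*c-high : ∀ r m → κ r * c r (suc (r ℕ.+ m)) ≈ - κ m
  κ*c-high r m = trans (κ*c r (suc (r ℕ.+ m)) m (suc (2 ℕ.* r)) (tri-reflect r m) (lem r m))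
    (trans (*-congʳ (*-congˡ (-1^[2*k] r))) (solve 1 (λ a → (:- con (+ 1)) :* con (+ 1) :* a := :- a) refl _))
    where
    lem : ∀ i m → i ℕ.+ (1 ℕ.+ (i ℕ.+ m)) ≡ 1 ℕ.+ 2 ℕ.* i ℕ.+ m
    lem = solve-∀

  t₁ t₂ : ℕ → Carrier
  t₁ m = q ^ (1 ℕ.+ 3 ℕ.* m)
  t₂ m = q ^ (2 ℕ.+ 3 ℕ.* m)

  -- The sum of κ(m) n/(1 - q^(3m+1)) over -r ≤ m < r. The index -(m + 1) gives the second summand:
  -- the triangular number is unchanged, the sign flips, and 1/(1 - 1/t) = -t/(1 - t).
  Y : ℕ → Carrier
  Y r = ∑ r (λ m → κ m * (V (t₁ m) + t₂ m * V (t₂ m)))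

  Y-split : ∀ r → Y r ≈ ∑ r (λ m → κ m * V (t₁ m)) + ∑ r (λ m → κ m * (t₂ m * V (t₂ m)))
  Y-split r = trans (∑-cong r (λ m _ → distribˡ _ _ _)) (∑-+ r _ _)

  q^*y^ : ∀ a i {k} → a ℕ.+ 3 ℕ.* i ≡ n ℕ.* k → q ^ a * y ^ i ≈ 1#
  q^*y^ a i {k} e = trans (*-congˡ (^-assocʳ q 3 i)) (trans (sym (^-homo-* q a (3 ℕ.* i)))
    (trans (^-congʳ q e) (q^[n*k]≈1 k)))

  x^≈q^ : ∀ a i → a ℕ.+ 3 ℕ.* i ≡ n → x ^ i ≈ q ^ a
  x^≈q^ a i e = inverse-unique (x^y^ i) (q^*y^ a i {1} (≡.trans e (≡.sym (ℕP.*-identityʳ n))))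

  q^*x^ : ∀ a i → 3 ℕ.* i ≡ n ℕ.+ a → q ^ a * x ^ i ≈ 1#
  q^*x^ a i e = trans (*-congʳ q^a≈y^i) (trans (*-comm _ _) (x^y^ i))
    where
    q^a≈y^i : q ^ a ≈ y ^ i
    q^a≈y^i = begin
      q ^ a              ≈⟨ *-identityˡ _ ⟨
      1# * q ^ a         ≈⟨ *-congʳ q^n≈1 ⟨
      q ^ n * q ^ a      ≈⟨ ^-homo-* q n a ⟨
      q ^ (n ℕ.+ a)      ≈⟨ ^-congʳ q e ⟨
      q ^ (3 ℕ.* i)      ≈⟨ ^-assocʳ q 3 i ⟨
      y ^ i              ∎

  module _ (coprime : ∀ i → n ∣ 3 ℕ.* i → n ∣ i) where
    open Coprime-3 coprime

    -- The summand of index i in F is the one with denominator 1 - q^(3m + 1), where i = r - m and m may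
    -- be negative.
    2Y-1-mod-3 : ∀ r → n ≡ 1 ℕ.+ 3 ℕ.* r → Y r + Y r ≈ κ r * (r ·1 * N)
    2Y-1-mod-3 r n≡1+3r = begin
      Y r + Y r                     ≈⟨ +-cong Y≈κF Y≈κF ⟩
      κ r * - S + κ r * - S         ≈⟨ solve 2 (λ k s → k :* (:- s) :+ k :* (:- s) := k :* (:- (s :+ s))) refl _ _ ⟩
      κ r * - (S + S)               ≈⟨ *-congˡ (-‿cong (L-sum r r (≡.trans (lem₀ r) (≡.sym n≡1+3r)))) ⟩
      κ r * - - (r ·1 * N)          ≈⟨ solve 2 (λ k s → k :* (:- :- s) := k :* s) refl _ _ ⟩
      κ r * (r ·1 * N)              ∎
      where
      S = ∑ r (λ u → L (suc (r ℕ.+ u)))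
      lem₀ : ∀ r → 1 ℕ.+ (r ℕ.+ r ℕ.+ r) ≡ 1 ℕ.+ 3 ℕ.* r
      lem₀ = solve-∀
      2r<n : r ℕ.+ r < n
      2r<n = ≡.subst (r ℕ.+ r <_) (≡.trans (lem₀ r) (≡.sym n≡1+3r)) (s≤s (ℕP.m≤m+n (r ℕ.+ r) r))

      low : ∀ m j → suc (m ℕ.+ j) ≡ r → κ m * V (t₁ m) ≈ κ r * (c r (suc j) * U (suc j))
      low m j e = begin
        κ m * V (t₁ m)                       ≈⟨ *-congˡ (V-cong (sym (x^≈q^ (1 ℕ.+ 3 ℕ.* m) (suc j) (eq j e)))) ⟩
        κ m * U (suc j)                      ≈⟨ *-congʳ (κ*c-low (suc j) m) ⟨
        κ (suc j ℕ.+ m) * c (suc j ℕ.+ m) (suc j) * U (suc j)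
          ≡⟨ ≡.cong (λ k → κ k * c k (suc j) * U (suc j)) (≡.trans (≡.cong suc (ℕP.+-comm j m)) e) ⟩
        κ r * c r (suc j) * U (suc j)        ≈⟨ *-assoc _ _ _ ⟩
        κ r * (c r (suc j) * U (suc j))      ∎
        where
        eq : ∀ j → suc (m ℕ.+ j) ≡ r → 1 ℕ.+ 3 ℕ.* m ℕ.+ 3 ℕ.* suc j ≡ n
        eq j ≡.refl = ≡.trans (lem m j) (≡.sym n≡1+3r)
          where
          lem : ∀ m j → 1 ℕ.+ 3 ℕ.* m ℕ.+ 3 ℕ.* (1 ℕ.+ j) ≡ 1 ℕ.+ 3 ℕ.* (1 ℕ.+ (m ℕ.+ j))
          lem = solve-∀

      high : ∀ m → m < r → κ m * (t₂ m * V (t₂ m)) ≈ κ r * (c r (suc (r ℕ.+ m)) * U (suc (r ℕ.+ m)))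
      high m m<r = begin
        κ m * (t₂ m * V (t₂ m))              ≈⟨ *-congˡ (V-inverse-root
            (q^*x^ (2 ℕ.+ 3 ℕ.* m) i (≡.trans (lem r m) (≡.cong (ℕ._+ (2 ℕ.+ 3 ℕ.* m)) (≡.sym n≡1+3r))))
                                                  (q^-^n (2 ℕ.+ 3 ℕ.* m)) (q^-regular (2 ℕ.+ 3 ℕ.* m) (s≤s z≤n)
                                                      j<n)) ⟩
        κ m * - U i                          ≈⟨ solve 2 (λ k u → k :* (:- u) := (:- k) :* u) refl _ _ ⟩
        - κ m * U i                          ≈⟨ *-congʳ (κ*c-high r m) ⟨
        κ r * c r i * U i                    ≈⟨ *-assoc _ _ _ ⟩
        κ r * (c r i * U i)                  ∎
        where
        i = suc (r ℕ.+ m)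
        lem : ∀ r m → 3 ℕ.* (1 ℕ.+ (r ℕ.+ m)) ≡ 1 ℕ.+ 3 ℕ.* r ℕ.+ (2 ℕ.+ 3 ℕ.* m)
        lem = solve-∀
        j<n : 2 ℕ.+ 3 ℕ.* m < n
        j<n = ≡.subst (2 ℕ.+ 3 ℕ.* m <_) (≡.sym n≡1+3r)
          (ℕP.m≤n⇒m≤1+n (≡.subst (_≤ 3 ℕ.* r) (ℕP.*-suc 3 m) (ℕP.*-monoʳ-≤ 3 m<r)))

      Y≈κF : Y r ≈ κ r * - S
      Y≈κF = begin
        Y r
          ≈⟨ Y-split r ⟩
        ∑ r (λ m → κ m * V (t₁ m)) + ∑ r (λ m → κ m * (t₂ m * V (t₂ m)))
          ≈⟨ +-cong (∑-reverse r low) (∑-cong r high) ⟩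
        ∑ r (λ j → κ r * (c r (suc j) * U (suc j))) + ∑ r (λ m → κ r * (c r (suc (r ℕ.+ m)) * U (suc (r ℕ.+ m))))
          ≈⟨ ∑-split r r _ ⟨
        ∑ (r ℕ.+ r) (λ j → κ r * (c r (suc j) * U (suc j)))
          ≈⟨ ∑-* (r ℕ.+ r) (κ r) _ ⟩
        κ r * F r (r ℕ.+ r)
          ≈⟨ *-congˡ (F-closed r 2r<n) ⟩
        κ r * - S ∎

    -- Now 3m + 2 = n - 3(r - m), so `t₁` and `t₂` exchange their roles, and the numerator that
    -- comes with each denominator raises the parameter of `F` from r to r + 1. The extra term is
    -- the index j = n - 1, which belongs to the last, incomplete block.
    2X-2-mod-3 : ∀ r → n ≡ 2 ℕ.+ 3 ℕ.* r → let X = Y r + κ r * V (t₁ r) in X + X ≈ κ r * (suc r ·1 * N)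
    2X-2-mod-3 r n≡2+3r = begin
      X + X                             ≈⟨ +-cong X≈κF X≈κF ⟩
      κ r * - S + κ r * - S             ≈⟨ solve 2 (λ k s → k :* (:- s) :+ k :* (:- s) := k :* (:- (s :+ s)))
          refl _ _ ⟩
      κ r * - (S + S)                   ≈⟨ *-congˡ (-‿cong (L-sum r (suc r) (≡.trans (lem₀ r) (≡.sym n≡2+3r)))) ⟩
      κ r * - - (suc r ·1 * N)          ≈⟨ solve 2 (λ k s → k :* (:- :- s) := k :* s) refl _ _ ⟩
      κ r * (suc r ·1 * N)              ∎
      where
      X = Y r + κ r * V (t₁ r)
      S = ∑ (suc r) (λ u → L (suc (r ℕ.+ u)))
      lem₀ : ∀ r → 1 ℕ.+ (r ℕ.+ r ℕ.+ (1 ℕ.+ r)) ≡ 2 ℕ.+ 3 ℕ.* r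
      lem₀ = solve-∀
      2r<n : suc (r ℕ.+ r) < n
      2r<n = ≡.subst (suc (r ℕ.+ r) <_) (≡.trans (lem₀ r) (≡.sym n≡2+3r))
        (s≤s (≡.subst (suc (r ℕ.+ r) ≤_) (≡.sym (ℕP.+-suc (r ℕ.+ r) r)) (s≤s (ℕP.m≤m+n (r ℕ.+ r) r))))

      low : ∀ m j → suc (m ℕ.+ j) ≡ r → κ m * (t₂ m * V (t₂ m)) ≈ κ r * (c (suc r) (suc j) * U (suc j))
      low m j e = begin
        κ m * (t₂ m * V (t₂ m))              ≈⟨ *-congˡ (*-cong (sym t) (V-cong (sym t))) ⟩
        κ m * (x ^ suc j * U (suc j))        ≈⟨ *-congʳ (κ*c-low (suc j) m) ⟨
        κ (suc j ℕ.+ m) * c (suc j ℕ.+ m) (suc j) * (x ^ suc j * U (suc j))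
          ≡⟨ ≡.cong (λ k → κ k * c k (suc j) * (x ^ suc j * U (suc j))) (≡.trans (≡.cong suc (ℕP.+-comm j m)) e) ⟩
        κ r * c r (suc j) * (x ^ suc j * U (suc j))
          ≈⟨ solve 4 (λ a b c d → a :* b :* (c :* d) := a :* (b :* c :* d)) refl _ _ _ _ ⟩
        κ r * (c r (suc j) * x ^ suc j * U (suc j))
          ≈⟨ *-congˡ (*-congʳ (c-scale r (suc j))) ⟨
        κ r * (c (suc r) (suc j) * U (suc j)) ∎
        where
        eq : ∀ j → suc (m ℕ.+ j) ≡ r → 2 ℕ.+ 3 ℕ.* m ℕ.+ 3 ℕ.* suc j ≡ n
        eq j ≡.refl = ≡.trans (lem m j) (≡.sym n≡2+3r)
          where
          lem : ∀ m j → 2 ℕ.+ 3 ℕ.* m ℕ.+ 3 ℕ.* (1 ℕ.+ j) ≡ 2 ℕ.+ 3 ℕ.* (1 ℕ.+ (m ℕ.+ j))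
          lem = solve-∀
        t : x ^ suc j ≈ t₂ m
        t = x^≈q^ (2 ℕ.+ 3 ℕ.* m) (suc j) (eq j e)

      high : ∀ m → m < suc r → κ m * V (t₁ m) ≈ κ r * (c (suc r) (suc (r ℕ.+ m)) * U (suc (r ℕ.+ m)))
      high m m<1+r = begin
        κ m * V (t₁ m)                       ≈⟨ *-congˡ (solve 1 (λ a → a := :- :- a) refl _) ⟩
        κ m * - - V (t₁ m)                   ≈⟨ *-congˡ (-‿cong
            (V-inverse-root (trans (*-comm _ _) q^*x^i≈1) (x^n≈1 i)
            (inverse-regular q^*x^i≈1 (q^-regular (1 ℕ.+ 3 ℕ.* m) (s≤s z≤n) j<n)))) ⟨
        κ m * - (x ^ i * U i)                ≈⟨ solve 3 (λ k t u → k :* (:- (t :* u)) := (:- k) :* (t :* u))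
            refl _ _ _ ⟩
        - κ m * (x ^ i * U i)                ≈⟨ *-congʳ (κ*c-high r m) ⟨
        κ r * c r i * (x ^ i * U i)          ≈⟨ solve 4 (λ a b c d → a :* b :* (c :* d) := a :* (b :* c :* d))
            refl _ _ _ _ ⟩
        κ r * (c r i * x ^ i * U i)          ≈⟨ *-congˡ (*-congʳ (c-scale r i)) ⟨
        κ r * (c (suc r) i * U i)            ∎
        where
        i = suc (r ℕ.+ m)
        lem : ∀ r m → 3 ℕ.* (1 ℕ.+ (r ℕ.+ m)) ≡ 2 ℕ.+ 3 ℕ.* r ℕ.+ (1 ℕ.+ 3 ℕ.* m)
        lem = solve-∀
        q^*x^i≈1 : t₁ m * x ^ i ≈ 1#
        q^*x^i≈1 = q^*x^ (1 ℕ.+ 3 ℕ.* m) i (≡.trans (lem r m) (≡.cong (ℕ._+ (1 ℕ.+ 3 ℕ.* m)) (≡.sym n≡2+3r)))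
        j<n : 1 ℕ.+ 3 ℕ.* m < n
        j<n = ≡.subst (1 ℕ.+ 3 ℕ.* m <_) (≡.sym n≡2+3r) (s≤s (s≤s (ℕP.*-monoʳ-≤ 3 (ℕP.≤-pred m<1+r))))

      X≈κF : X ≈ κ r * - S
      X≈κF = begin
        X
          ≈⟨ +-congʳ (Y-split r) ⟩
        ∑ r (λ m → κ m * V (t₁ m)) + ∑ r (λ m → κ m * (t₂ m * V (t₂ m))) + κ r * V (t₁ r)
          ≈⟨ solve 3 (λ a b c → a :+ b :+ c := b :+ (a :+ c)) refl _ _ _ ⟩
        ∑ r (λ m → κ m * (t₂ m * V (t₂ m))) + ∑ (suc r) (λ m → κ m * V (t₁ m))
          ≈⟨ +-cong (∑-reverse r low) (∑-cong (suc r) high) ⟩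
        ∑ r (λ j → κ r * (c (suc r) (suc j) * U (suc j))) + ∑ (suc r)
            (λ m → κ r * (c (suc r) (suc (r ℕ.+ m)) * U (suc (r ℕ.+ m))))
          ≈⟨ ∑-split r (suc r) (λ j → κ r * (c (suc r) (suc j) * U (suc j))) ⟨
        ∑ (r ℕ.+ suc r) (λ j → κ r * (c (suc r) (suc j) * U (suc j)))
          ≈⟨ ∑-* (r ℕ.+ suc r) (κ r) _ ⟩
        κ r * F (suc r) (r ℕ.+ suc r)
          ≡⟨ ≡.cong (λ k → κ r * F (suc r) k) (ℕP.+-suc r r) ⟩
        κ r * F (suc r) (suc (r ℕ.+ r))
          ≈⟨ *-congˡ (F-closed-odd r 2r<n) ⟩
        κ r * - S ∎

  -- Under m ↦ r - 1 - m the root `t₂` becomes the inverse of `t₁` and `κ` is invariant, so t/(1 -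
  -- t) = -1/(1 - 1/t) pairs opposite terms.
  Y-0-mod-3 : ∀ r → n ≡ 3 ℕ.* r → Y r ≈ 0#
  Y-0-mod-3 r n≡3r = begin
    Y r                                      ≈⟨ Y-split r ⟩
    ∑ r (λ m → κ m * V (t₁ m)) + ∑ r (λ m → κ m * (t₂ m * V (t₂ m)))
      ≈⟨ +-congˡ (∑-reverse r (λ m m′ e → reflected m m′ e)) ⟩
    ∑ r (λ m → κ m * V (t₁ m)) + ∑ r (λ m → (- 1#) * (κ m * V (t₁ m)))
      ≈⟨ +-congˡ (∑-* r (- 1#) _) ⟩
    ∑ r (λ m → κ m * V (t₁ m)) + (- 1#) * ∑ r (λ m → κ m * V (t₁ m))
      ≈⟨ solve 1 (λ a → a :+ (:- con (+ 1)) :* a := con (+ 0)) refl _ ⟩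
    0# ∎
    where
    reflected : ∀ m m′ → suc (m ℕ.+ m′) ≡ r → κ m * (t₂ m * V (t₂ m)) ≈ (- 1#) * (κ m′ * V (t₁ m′))
    reflected m m′ ≡.refl = begin
      κ m * (t₂ m * V (t₂ m))       ≈⟨ *-cong κ≈ (V-inverse-root tt′ (q^-^n (2 ℕ.+ 3 ℕ.* m))
          (q^-regular (2 ℕ.+ 3 ℕ.* m) (s≤s z≤n) j<n)) ⟩
      κ m′ * - V (t₁ m′)            ≈⟨ solve 2 (λ k v → k :* (:- v) := (:- con (+ 1)) :* (k :* v)) refl _ _ ⟩
      (- 1#) * (κ m′ * V (t₁ m′))   ∎
      where
      lem₁ : ∀ m m′ → 2 ℕ.+ 3 ℕ.* m ℕ.+ (1 ℕ.+ 3 ℕ.* m′) ≡ 3 ℕ.* (1 ℕ.+ (m ℕ.+ m′))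
      lem₁ = solve-∀
      sum≡n : 2 ℕ.+ 3 ℕ.* m ℕ.+ (1 ℕ.+ 3 ℕ.* m′) ≡ n
      sum≡n = ≡.trans (lem₁ m m′) (≡.sym n≡3r)
      j<n : 2 ℕ.+ 3 ℕ.* m < n
      j<n = ≡.subst (2 ℕ.+ 3 ℕ.* m <_) sum≡n (ℕP.m<m+n _ (s≤s z≤n))
      tt′ : t₂ m * t₁ m′ ≈ 1#
      tt′ = trans (sym (^-homo-* q (2 ℕ.+ 3 ℕ.* m) (1 ℕ.+ 3 ℕ.* m′))) (trans (^-congʳ q sum≡n) q^n≈1)
      y^r≈1 : y ^ suc (m ℕ.+ m′) ≈ 1#
      y^r≈1 = trans (^-assocʳ q 3 (suc (m ℕ.+ m′))) (trans (^-congʳ q (≡.sym n≡3r)) q^n≈1)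
      κ≈ : κ m ≈ κ m′
      κ≈ = begin
        κ m                                       ≈⟨ κ*c-low m′ m ⟨
        κ (m′ ℕ.+ m) * c (m′ ℕ.+ m) m′            ≡⟨ ≡.cong (λ k → κ k * c k m′) (ℕP.+-comm m′ m) ⟩
        κ ρ * c ρ m′                              ≈⟨ *-cong κρ≈1 (*-congʳ (*-congˡ x^≈y^)) ⟩
        1# * ((- 1#) ^ m′ * y ^ m′ * y ^ tri m′)  ≈⟨ trans (*-identityˡ _) (*-assoc _ _ _) ⟩
        (- 1#) ^ m′ * (y ^ m′ * y ^ tri m′)       ≈⟨ *-congˡ (^-homo-* y m′ (tri m′)) ⟨
        κ m′                                      ∎
        where
        ρ = m ℕ.+ m′
        -- Here y^(ρ+1) = q^n = 1, so ρ acts as -1 in exponents of `x`.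
        x^≈y^ : x ^ (ρ ℕ.* m′) ≈ y ^ m′
        x^≈y^ = inverse-unique
          (trans (sym (^-homo-* x (ρ ℕ.* m′) m′)) (trans (^-congʳ x (ℕP.+-comm (ρ ℕ.* m′) m′))
            (trans (sym (^-assocʳ x (suc ρ) m′)) (^-≡1 m′ (inverse-unit (suc ρ) y^r≈1)))))
          (trans (*-comm _ _) (x^y^ m′))
          where
          inverse-unit : ∀ k → y ^ k ≈ 1# → x ^ k ≈ 1#
          inverse-unit k h = trans (sym (*-identityʳ _)) (trans (*-congˡ (sym h)) (x^y^ k))
        κρ≈1 : κ ρ ≈ 1#
        κρ≈1 = begin
          (- 1#) ^ ρ * y ^ tri (suc ρ)            ≈⟨ *-congˡ
              (trans (^-assocʳ q 3 (tri (suc ρ))) (q^half ρ {3 ℕ.* tri (suc ρ)} half)) ⟩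
          (- 1#) ^ ρ * (- 1#) ^ ρ                 ≈⟨ ^-homo-* (- 1#) ρ ρ ⟨
          (- 1#) ^ (ρ ℕ.+ ρ)                      ≈⟨ ^-congʳ (- 1#) (≡.cong (ρ ℕ.+_) (≡.sym (ℕP.+-identityʳ ρ))) ⟩
          (- 1#) ^ (2 ℕ.* ρ)                      ≈⟨ -1^[2*k] ρ ⟩
          1#                                      ∎
          where
          lem₂ : ∀ a → 3 ℕ.* (2 ℕ.* a) ≡ 2 ℕ.* (3 ℕ.* a)
          lem₂ = solve-∀
          half : n ℕ.* ρ ≡ 2 ℕ.* (3 ℕ.* tri (suc ρ))
          half = ≡.trans (≡.cong (ℕ._* ρ) n≡3r) (≡.trans (ℕP.*-assoc 3 (suc ρ) ρ)
            (≡.trans (≡.cong (3 ℕ.*_) (≡.sym (2*tri ρ))) (lem₂ (tri (suc ρ)))))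

  -- As nr is even, the sign (-1)^r is q^(nr/2), and nr/2 + 3r(r + 1)/2 = nr + r.
  κ-1-mod-3 : ∀ r → n ≡ 1 ℕ.+ 3 ℕ.* r → κ r ≈ q ^ r
  κ-1-mod-3 r n≡1+3r = begin
    (- 1#) ^ r * y ^ T          ≈⟨ *-cong (sym (q^half r {h} half)) (^-assocʳ q 3 T) ⟩
    q ^ h * q ^ (3 ℕ.* T)       ≈⟨ ^-homo-* q h (3 ℕ.* T) ⟨
    q ^ (h ℕ.+ 3 ℕ.* T)         ≈⟨ ^-congʳ q (≡.trans sum (ℕP.+-comm (n ℕ.* r) r)) ⟩
    q ^ (r ℕ.+ n ℕ.* r)         ≈⟨ ^-homo-* q r (n ℕ.* r) ⟩
    q ^ r * q ^ (n ℕ.* r)       ≈⟨ trans (*-congˡ (q^[n*k]≈1 r)) (*-identityʳ _) ⟩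
    q ^ r                       ∎
    where
    T = tri (suc r)
    -- This is nr/2, written without division.
    h = r ℕ.+ r ℕ.+ 3 ℕ.* tri r
    6T : 3 ℕ.* (suc r ℕ.* r) ≡ 3 ℕ.* (2 ℕ.* T)
    6T = ≡.cong (3 ℕ.*_) (≡.sym (2*tri r))
    half : n ℕ.* r ≡ 2 ℕ.* h
    half = ≡.trans (≡.cong (ℕ._* r) n≡1+3r)
      (ℕP.+-cancelʳ-≡ (2 ℕ.* r) _ _ (≡.trans (lem₁ r) (≡.trans 6T (lem₂ r (tri r)))))
      where
      lem₁ : ∀ r → (1 ℕ.+ 3 ℕ.* r) ℕ.* r ℕ.+ 2 ℕ.* r ≡ 3 ℕ.* ((1 ℕ.+ r) ℕ.* r)
      lem₁ = solve-∀
      lem₂ : ∀ r t → 3 ℕ.* (2 ℕ.* (r ℕ.+ t)) ≡ 2 ℕ.* (r ℕ.+ r ℕ.+ 3 ℕ.* t) ℕ.+ 2 ℕ.* r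
      lem₂ = solve-∀
    sum : h ℕ.+ 3 ℕ.* T ≡ n ℕ.* r ℕ.+ r
    sum = ≡.trans (lem r (tri r)) (≡.cong (ℕ._+ r) (≡.sym half))
      where
      lem : ∀ r t → r ℕ.+ r ℕ.+ 3 ℕ.* t ℕ.+ 3 ℕ.* (r ℕ.+ t) ≡ 2 ℕ.* (r ℕ.+ r ℕ.+ 3 ℕ.* t) ℕ.+ r
      lem = solve-∀

  -- The total exponent 3r(r + 1)/2 + r + 1 is n(r + 1)/2, so the power of q is (-1)^(r+1).
  κ-2-mod-3 : ∀ r → n ≡ 2 ℕ.+ 3 ℕ.* r → κ r * q ^ suc r ≈ - 1#
  κ-2-mod-3 r n≡2+3r = begin
    (- 1#) ^ r * y ^ T * q ^ suc r          ≈⟨ trans (*-congʳ (*-congˡ (^-assocʳ q 3 T))) (*-assoc _ _ _) ⟩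
    (- 1#) ^ r * (q ^ (3 ℕ.* T) * q ^ suc r) ≈⟨ *-congˡ (trans (sym (^-homo-* q (3 ℕ.* T) (suc r)))
        (q^half (suc r) {3 ℕ.* T ℕ.+ suc r} half)) ⟩
    (- 1#) ^ r * (- 1# * (- 1#) ^ r)        ≈⟨ solve 1 (λ e → e :* (:- con (+ 1) :* e) := :- (e :* e)) refl _ ⟩
    - ((- 1#) ^ r * (- 1#) ^ r)             ≈⟨ -‿cong (trans (sym (^-homo-* (- 1#) r r))
        (trans (^-congʳ (- 1#) (≡.cong (r ℕ.+_) (≡.sym (ℕP.+-identityʳ r)))) (-1^[2*k] r))) ⟩
    - 1#                                    ∎
    where
    T = tri (suc r)
    half : n ℕ.* suc r ≡ 2 ℕ.* (3 ℕ.* T ℕ.+ suc r)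
    half = ≡.trans (≡.cong (ℕ._* suc r) n≡2+3r) (≡.trans (lem₁ r)
      (≡.trans (≡.cong (λ k → 3 ℕ.* k ℕ.+ 2 ℕ.* suc r) (≡.sym (2*tri r))) (lem₂ T r)))
      where
      lem₁ : ∀ r → (2 ℕ.+ 3 ℕ.* r) ℕ.* (1 ℕ.+ r) ≡ 3 ℕ.* ((1 ℕ.+ r) ℕ.* r) ℕ.+ 2 ℕ.* (1 ℕ.+ r)
      lem₁ = solve-∀
      lem₂ : ∀ t r → 3 ℕ.* (2 ℕ.* t) ℕ.+ 2 ℕ.* (1 ℕ.+ r) ≡ 2 ℕ.* (3 ℕ.* t ℕ.+ (1 ℕ.+ r))
      lem₂ = solve-∀

-- Quotients by a principal ideal, as a coarser equality on the same carrier.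

module Quotient (R : CommutativeRing 0ℓ 0ℓ) (m : CommutativeRing.Carrier R) where
  open Arithmetic R

  infix 4 _≋_
  _≋_ : Carrier → Carrier → Set
  a ≋ b = ∃ λ w → a ≈ b + m * w

  ≈⇒≋ : ∀ {a b} → a ≈ b → a ≋ b
  ≈⇒≋ {a} {b} h = 0# , trans h (solve 2 (λ b m → b := b :+ m :* con (+ 0)) refl b m)

  quotient : CommutativeRing 0ℓ 0ℓ
  quotient = record
    { Carrier = Carrier ; _≈_ = _≋_ ; _+_ = _+_ ; _*_ = _*_ ; -_ = -_ ; 0# = 0# ; 1# = 1#
    ; isCommutativeRing = record
      { isRing = record
        { +-isAbelianGroup = record
          { isGroup = record
            { isMonoid = record
              { isSemigroup = record
                { isMagma = record { isEquivalence = record { refl = ≈⇒≋ refl ; sym = ≋-sym ; trans = ≋-trans } ;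
                    ∙-cong = ≋-+ }
                ; assoc = λ a b c → ≈⇒≋ (+-assoc a b c) }
              ; identity = (λ a → ≈⇒≋ (+-identityˡ a)) , (λ a → ≈⇒≋ (+-identityʳ a)) }
            ; inverse = (λ a → ≈⇒≋ (-‿inverseˡ a)) , (λ a → ≈⇒≋ (-‿inverseʳ a))
            ; ⁻¹-cong = ≋-neg }
          ; comm = λ a b → ≈⇒≋ (+-comm a b) }
        ; *-cong = ≋-*
        ; *-assoc = λ a b c → ≈⇒≋ (*-assoc a b c)
        ; *-identity = (λ a → ≈⇒≋ (*-identityˡ a)) , (λ a → ≈⇒≋ (*-identityʳ a))
        ; distrib = (λ a b c → ≈⇒≋ (distribˡ a b c)) , (λ a b c → ≈⇒≋ (distribʳ a b c)) }
      ; *-comm = λ a b → ≈⇒≋ (*-comm a b) } }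
    where
    ≋-sym : ∀ {a b} → a ≋ b → b ≋ a
    ≋-sym {a} {b} (w , h) = - w , trans
      (solve 3 (λ b m w → b := b :+ m :* w :+ m :* (:- w)) refl b m w) (+-congʳ (sym h))
    ≋-trans : ∀ {a b c} → a ≋ b → b ≋ c → a ≋ c
    ≋-trans {a} {b} {c} (w , h) (w′ , h′) = w + w′ , trans h (trans (+-congʳ h′)
      (solve 4 (λ c m w v → c :+ m :* v :+ m :* w := c :+ m :* (w :+ v)) refl c m w w′))
    ≋-+ : ∀ {a b c d} → a ≋ b → c ≋ d → a + c ≋ b + d
    ≋-+ {a} {b} {c} {d} (w , h) (w′ , h′) = w + w′ , trans (+-cong h h′)
      (solve 5 (λ b d m w v → b :+ m :* w :+ (d :+ m :* v) := b :+ d :+ m :* (w :+ v)) refl b d m w w′)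
    ≋-* : ∀ {a b c d} → a ≋ b → c ≋ d → a * c ≋ b * d
    ≋-* {a} {b} {c} {d} (w , h) (w′ , h′) = b * w′ + w * d + m * w * w′ , trans (*-cong h h′)
      (solve 5 (λ b d m w v → (b :+ m :* w) :* (d :+ m :* v) := b :* d :+ m :* (b :* v :+ w :* d :+ m :* w :* v))
          refl b d m w w′)
    ≋-neg : ∀ {a b} → a ≋ b → - a ≋ - b
    ≋-neg {a} {b} (w , h) = - w , trans (-‿cong h)
      (solve 3 (λ b m w → :- (b :+ m :* w) := :- b :+ m :* (:- w)) refl b m w)

-- The central sum modulo the square of φ.

module Supercongruence
  (R : CommutativeRing 0ℓ 0ℓ) (n′ : ℕ) (q φ : CommutativeRing.Carrier R)
  (root : RegularRoot (Quotient.quotient R φ) (suc n′) q) where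
  open Arithmetic R
  open Gaussian R q
  module Mod  = Quotient R φ
  module Mod² = Quotient R (φ * φ)
  module R₁ = Arithmetic Mod.quotient
  module R₂ = Arithmetic Mod².quotient
  open R₁ using () renaming (_≈_ to _≈₁_)
  open R₂ using () renaming (_≈_ to _≈₂_)
  open RegularRoot root
  open RootOfUnity Mod.quotient n′ q root hiding (x)

  ε : Carrier
  ε = 1# - q ^ n

  ε≈₁0 : ε ≈₁ 0#
  ε≈₁0 = R₁.trans (R₁.+-congˡ (R₁.-‿cong q^n≈1)) (R₁.-‿inverseʳ 1#)

  -- A multiple of φ only needs its cofactor modulo φ.
  *-lift : ∀ {w a b} → w ≈₁ 0# → a ≈₁ b → w * a ≈₂ w * b
  *-lift {w} {a} {b} (v , w≈) (u , a≈) = v * u , (begin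
    w * a                          ≈⟨ *-congˡ a≈ ⟩
    w * (b + φ * u)                ≈⟨ trans (distribˡ _ _ _) (+-congˡ (*-congʳ w≈)) ⟩
    w * b + (0# + φ * v) * (φ * u) ≈⟨ solve 4 (λ c f v u → c :+ (con (+ 0) :+ f :* v) :* (f :* u) := c :+ f :* f :*
        (v :* u)) refl (w * b) φ v u ⟩
    w * b + φ * φ * (v * u)        ∎)

  *-lift-0 : ∀ {w a} → w ≈₁ 0# → a ≈₁ 0# → w * a ≈₂ 0#
  *-lift-0 w≈0 a≈0 = R₂.trans (*-lift w≈0 a≈0) (R₂.zeroʳ _)

  cancel-q : ∀ k {a} → suc k < n → (1# - q ^ suc k) * a ≈₁ 0# → a ≈₁ 0#
  cancel-q k k<n = cancel (q^-regular (suc k) (s≤s z≤n) k<n)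

  q^[k+n]≈₁q^k : ∀ k → q ^ (k ℕ.+ n) ≈₁ q ^ k
  q^[k+n]≈₁q^k k = R₁.trans (Mod.≈⇒≋ (^-homo-* q k n)) (R₁.trans (R₁.*-congˡ q^n≈1) (R₁.*-identityʳ _))

  -- In `absorb` the factor 1 - q^(n+i+1) equals 1 - q^(i+1) modulo φ, and the latter can be
  -- cancelled.
  G-n+i : ∀ i → i < n → G (i ℕ.+ n) i ≈₁ 1#
  G-n+i zero    _   = R₁.refl
  G-n+i (suc i) i<n = R₁.x-y≈0⇒x≈y (cancel-q i i<n (R₁.begin
    (1# - q ^ suc i) * (g - 1#)
      R₁.≈⟨ Mod.≈⇒≋ (trans (solve 2 (λ a g → a :* (g :- con (+ 1)) := a :* g :- a) refl _ _)
          (+-congʳ (absorb i n))) ⟩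
    (1# - q ^ suc (i ℕ.+ n)) * G (i ℕ.+ n) i - (1# - q ^ suc i)
      R₁.≈⟨ R₁.+-congʳ (R₁.*-cong (R₁.+-congˡ (R₁.-‿cong (q^[k+n]≈₁q^k (suc i)))) (G-n+i i (ℕP.<⇒≤ i<n))) ⟩
    (1# - q ^ suc i) * 1# - (1# - q ^ suc i)
      R₁.≈⟨ Mod.≈⇒≋ (solve 1 (λ a → a :* con (+ 1) :- a := con (+ 0)) refl _) ⟩
    0# R₁.∎))
    where g = G (suc i ℕ.+ n) (suc i)

  -- The weight of `a` turns the factor 1 - q^(n-j) in the recurrence of `b` into q^j - q^n, which
  -- is 1 - q^n at j = 0 and differs from q^j - 1 by a multiple of φ.
  b a : ℕ → Carrier
  b j = G (n ℕ.+ n) (n ℕ.+ j)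
  a j = q ^ tri j * b j

  module CentralSum (ε-regular : ∀ {u v} → ε * u ≈ ε * v → u ≈ v) where
    -- Absorption gives [2n, n] = (1 + q^n) [2n - 1, n - 1] only after cancelling 1 - q^n, which is
    -- zero modulo φ; hence the cancellation in R.
    b-zero : b 0 ≈₁ 1# + 1#
    b-zero = R₁.begin
      b 0                           R₁.≡⟨ ≡.cong (G (n ℕ.+ n)) (ℕP.+-identityʳ n) ⟩
      G (n ℕ.+ n) n                 R₁.≈⟨ Mod.≈⇒≋ (ε-regular halves) ⟩
      (1# + q ^ n) * G (n′ ℕ.+ n) n′ R₁.≈⟨ R₁.*-cong (R₁.+-congˡ q^n≈1) (G-n+i n′ (ℕP.n<1+n n′)) ⟩
      (1# + 1#) * 1#                R₁.≈⟨ R₁.*-identityʳ _ ⟩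
      1# + 1#                       R₁.∎
      where
      halves : ε * G (n ℕ.+ n) n ≈ ε * ((1# + q ^ n) * G (n′ ℕ.+ n) n′)
      halves = begin
        ε * G (n ℕ.+ n) n                       ≈⟨ absorb n′ n ⟩
        (1# - q ^ (n ℕ.+ n)) * G (n′ ℕ.+ n) n′  ≈⟨ *-congʳ (+-congˡ (-‿cong (^-homo-* q n n))) ⟩
        (1# - q ^ n * q ^ n) * G (n′ ℕ.+ n) n′  ≈⟨ solve 2 (λ a g → (con (+ 1) :- a :* a) :* g := (con (+ 1) :- a)
            :* ((con (+ 1) :+ a) :* g)) refl _ _ ⟩
        ε * ((1# + q ^ n) * G (n′ ℕ.+ n) n′)    ∎

    a-suc : ∀ j → j ≤ n → (1# - q ^ suc (n ℕ.+ j)) * a (suc j) ≈ (q ^ j - q ^ n) * a j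
    a-suc j j≤n with ℕP.m≤n⇒∃[o]m+o≡n j≤n
    ... | d , j+d≡n = begin
      p * (q ^ (j ℕ.+ tri j) * b (suc j))
        ≈⟨ *-congˡ (*-congʳ (^-homo-* q j (tri j))) ⟩
      p * (q ^ j * q ^ tri j * b (suc j))
        ≈⟨ solve 4 (λ p x t g → p :* (x :* t :* g) := x :* t :* (p :* g)) refl _ _ _ _ ⟩
      q ^ j * q ^ tri j * (p * b (suc j))
        ≈⟨ *-congˡ step ⟩
      q ^ j * q ^ tri j * ((1# - q ^ d) * b j)
        ≈⟨ solve 4 (λ x t d g → x :* t :* ((con (+ 1) :- d) :* g) := (x :- x :* d) :* (t :* g)) refl _ _ _ _ ⟩
      (q ^ j - q ^ j * q ^ d) * a j
        ≈⟨ *-congʳ (+-congˡ (-‿cong (trans (sym (^-homo-* q j d)) (^-congʳ q j+d≡n)))) ⟩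
      (q ^ j - q ^ n) * a j ∎
      where
      p = 1# - q ^ suc (n ℕ.+ j)
      k+d : n ℕ.+ j ℕ.+ d ≡ n ℕ.+ n
      k+d = ≡.trans (ℕP.+-assoc n j d) (≡.cong (n ℕ.+_) j+d≡n)
      step : p * b (suc j) ≈ (1# - q ^ d) * b j
      step = begin
        p * b (suc j)                                 ≡⟨ ≡.cong₂ (λ N k → p * G N k) (≡.sym k+d) (ℕP.+-suc n j) ⟩
        p * G (n ℕ.+ j ℕ.+ d) (suc (n ℕ.+ j))         ≈⟨ absorbʳ (n ℕ.+ j) d ⟩
        (1# - q ^ d) * G (n ℕ.+ j ℕ.+ d) (n ℕ.+ j)    ≡⟨ ≡.cong (λ N → (1# - q ^ d) * G N (n ℕ.+ j)) k+d ⟩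
        (1# - q ^ d) * b j                            ∎

    a-vanishes : ∀ j → suc j < n → a (suc j) ≈₁ 0#
    a-vanishes j j<n = cancel-q j j<n (R₁.begin
      (1# - q ^ suc j) * a (suc j)
        R₁.≈⟨ R₁.*-congʳ (R₁.+-congˡ (R₁.-‿cong (R₁.trans (R₁.sym (q^[k+n]≈₁q^k (suc j)))
            (R₁.^-congʳ q (≡.cong suc (ℕP.+-comm j n)))))) ⟩
      (1# - q ^ suc (n ℕ.+ j)) * a (suc j)
        R₁.≈⟨ Mod.≈⇒≋ (a-suc j (ℕP.<⇒≤ (ℕP.<⇒≤ j<n))) ⟩
      (q ^ j - q ^ n) * a j
        R₁.≈⟨ rhs j j<n ⟩
      0# R₁.∎)
      where
      rhs : ∀ j → suc j < n → (q ^ j - q ^ n) * a j ≈₁ 0#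
      rhs zero    _   = R₁.trans (R₁.*-congʳ ε≈₁0) (R₁.zeroˡ _)
      rhs (suc j) j<n = R₁.trans (R₁.*-congˡ (a-vanishes j (ℕP.<⇒≤ j<n))) (R₁.zeroʳ _)

    δ : Carrier
    δ = ε * (1# + 1#)

    -- In `a-suc`, 1 - q^(n+j+1) is 1 - q^(j+1) plus a multiple of ε, and q^j - q^n is ε - (1 -
    -- q^j). For positive indices ε times `a` vanishes modulo φ², so (1 - q^j) a_j merely
    -- alternates, starting from ε [2n, n].
    [1-q^j]a : ∀ j → suc j < n → (1# - q ^ suc j) * a (suc j) ≈₂ (- 1#) ^ j * δ
    [1-q^j]a j j<n = R₂.begin
      (1# - q ^ suc j) * a (suc j)
        R₂.≈⟨ Mod².≈⇒≋ expand ⟩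
      ε * a j - (1# - q ^ j) * a j - q ^ suc j * (ε * a (suc j))
        R₂.≈⟨ R₂.+-cong (previous j j<n) (R₂.-‿cong (R₂.*-congˡ (*-lift-0 ε≈₁0 (a-vanishes j j<n)))) ⟩
      (- 1#) ^ j * δ - q ^ suc j * 0#
        R₂.≈⟨ Mod².≈⇒≋ (solve 2 (λ x y → x :- y :* con (+ 0) := x) refl _ _) ⟩
      (- 1#) ^ j * δ R₂.∎
      where
      expand : (1# - q ^ suc j) * a (suc j) ≈ ε * a j - (1# - q ^ j) * a j - q ^ suc j * (ε * a (suc j))
      expand = begin
        (1# - q ^ suc j) * a (suc j)
          ≈⟨ solve 3 (λ u v x → (con (+ 1) :- u) :* x := (con (+ 1) :- v :* u) :* x :- u :*
              ((con (+ 1) :- v) :* x)) refl _ (q ^ n) _ ⟩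
        (1# - q ^ n * q ^ suc j) * a (suc j) - q ^ suc j * (ε * a (suc j))
          ≈⟨ +-congʳ (*-congʳ (+-congˡ (-‿cong (trans (sym (^-homo-* q n (suc j))) (^-congʳ q (ℕP.+-suc n j)))))) ⟩
        (1# - q ^ suc (n ℕ.+ j)) * a (suc j) - q ^ suc j * (ε * a (suc j))
          ≈⟨ +-congʳ (trans (a-suc j (ℕP.<⇒≤ (ℕP.<⇒≤ j<n)))
               (solve 3 (λ u v x → (u :- v) :* x := (con (+ 1) :- v) :* x :- (con (+ 1) :- u) :* x) refl _ _ _)) ⟩
        ε * a j - (1# - q ^ j) * a j - q ^ suc j * (ε * a (suc j)) ∎
      previous : ∀ j → suc j < n → ε * a j - (1# - q ^ j) * a j ≈₂ (- 1#) ^ j * δ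
      previous zero _ = R₂.begin
        ε * a 0 - (1# - 1#) * a 0
          R₂.≈⟨ Mod².≈⇒≋ (solve 2 (λ e x → e :* (con (+ 1) :* x) :- (con (+ 1) :- con (+ 1)) :* (con (+ 1) :* x)
              := e :* x) refl ε (b 0)) ⟩
        ε * b 0           R₂.≈⟨ *-lift ε≈₁0 b-zero ⟩
        δ                 R₂.≈⟨ R₂.*-identityˡ δ ⟨
        1# * δ            R₂.∎
      previous (suc j) j<n = R₂.begin
        ε * a (suc j) - (1# - q ^ suc j) * a (suc j)
          R₂.≈⟨ R₂.+-cong (*-lift-0 ε≈₁0 (a-vanishes j (ℕP.<⇒≤ j<n))) (R₂.-‿cong ([1-q^j]a j (ℕP.<⇒≤ j<n))) ⟩
        0# - (- 1#) ^ j * δ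
          R₂.≈⟨ Mod².≈⇒≋ (solve 2 (λ s d → con (+ 0) :- s :* d := :- con (+ 1) :* s :* d) refl _ _) ⟩
        (- 1#) ^ suc j * δ R₂.∎

    -- `V` inverts 1 - q^(j+1) up to n only modulo φ; this suffices because `a (suc j)` is itself a
    -- multiple of φ.
    N*a : ∀ j → suc j < n → N * a (suc j) ≈₂ (- 1#) ^ j * δ * V (q ^ suc j)
    N*a j j<n = R₂.begin
      N * a (suc j)
        R₂.≈⟨ R₂.*-comm _ _ ⟩
      a (suc j) * N
        R₂.≈⟨ *-lift (a-vanishes j j<n) (R₁.sym (V-inverse (q^-^n (suc j)) (q^-regular (suc j) (s≤s z≤n) j<n))) ⟩
      a (suc j) * ((1# - q ^ suc j) * V (q ^ suc j))
        R₂.≈⟨ Mod².≈⇒≋ (solve 3 (λ x y z → x :* (y :* z) := y :* x :* z) refl _ _ _) ⟩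
      (1# - q ^ suc j) * a (suc j) * V (q ^ suc j)
        R₂.≈⟨ R₂.*-congʳ ([1-q^j]a j j<n) ⟩
      (- 1#) ^ j * δ * V (q ^ suc j) R₂.∎

    e₁ e₂ : ℕ → ℕ
    e₁ m = 6 ℕ.* (m ℕ.* m) ℕ.+ 3 ℕ.* m
    e₂ m = 6 ℕ.* (m ℕ.* m) ℕ.+ 9 ℕ.* m ℕ.+ 3

    -- Splits the theta exponent into the power of y in `κ m` and the weight of `a`; `e₂-tri` leaves
    -- in addition the numerator `t₂ m`.
    e₁-tri : ∀ m → e₁ m ≡ 3 ℕ.* tri (suc m) ℕ.+ tri (1 ℕ.+ 3 ℕ.* m)
    e₁-tri m = ℕP.*-cancelˡ-≡ _ _ 2 (≡.trans (lem₁ m) (≡.trans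
      (≡.cong₂ (λ u v → 3 ℕ.* u ℕ.+ v) (≡.sym (2*tri m)) (≡.sym (2*tri (3 ℕ.* m))))
          (lem₂ (tri (suc m)) (tri (suc (3 ℕ.* m))))))
      where
      lem₁ : ∀ m → 2 ℕ.* (6 ℕ.* (m ℕ.* m) ℕ.+ 3 ℕ.* m) ≡ 3 ℕ.* ((1 ℕ.+ m) ℕ.* m) ℕ.+ (1 ℕ.+ 3 ℕ.* m) ℕ.* (3 ℕ.* m)
      lem₁ = solve-∀
      lem₂ : ∀ u v → 3 ℕ.* (2 ℕ.* u) ℕ.+ 2 ℕ.* v ≡ 2 ℕ.* (3 ℕ.* u ℕ.+ v)
      lem₂ = solve-∀

    e₂-tri : ∀ m → e₂ m ≡ 3 ℕ.* tri (suc m) ℕ.+ (2 ℕ.+ 3 ℕ.* m ℕ.+ tri (2 ℕ.+ 3 ℕ.* m))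
    e₂-tri m = ℕP.*-cancelˡ-≡ _ _ 2 (≡.trans (lem₁ m) (≡.trans
      (≡.cong₂ (λ u v → 3 ℕ.* u ℕ.+ (2 ℕ.* (2 ℕ.+ 3 ℕ.* m) ℕ.+ v)) (≡.sym (2*tri m))
          (≡.sym (2*tri (1 ℕ.+ 3 ℕ.* m))))
      (lem₂ (tri (suc m)) (2 ℕ.+ 3 ℕ.* m) (tri (2 ℕ.+ 3 ℕ.* m)))))
      where
      lem₁ : ∀ m → 2 ℕ.* (6 ℕ.* (m ℕ.* m) ℕ.+ 9 ℕ.* m ℕ.+ 3)
        ≡ 3 ℕ.* ((1 ℕ.+ m) ℕ.* m) ℕ.+ (2 ℕ.* (2 ℕ.+ 3 ℕ.* m) ℕ.+ (2 ℕ.+ 3 ℕ.* m) ℕ.* (1 ℕ.+ 3 ℕ.* m))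
      lem₁ = solve-∀
      lem₂ : ∀ u w v → 3 ℕ.* (2 ℕ.* u) ℕ.+ (2 ℕ.* w ℕ.+ 2 ℕ.* v) ≡ 2 ℕ.* (3 ℕ.* u ℕ.+ (w ℕ.+ v))
      lem₂ = solve-∀

    -1^[3*m] : ∀ m → (- 1#) ^ (3 ℕ.* m) ≈ (- 1#) ^ m
    -1^[3*m] m = trans (sym (^-assocʳ (- 1#) 3 m))
      (^-congˡ m (solve 0 (:- con (+ 1) :* (:- con (+ 1) :* (:- con (+ 1) :* con (+ 1))) := :- con (+ 1)) refl))

    first-term : ∀ m → 1 ℕ.+ 3 ℕ.* m < n →
      N * (q ^ e₁ m * b (1 ℕ.+ 3 ℕ.* m)) ≈₂ δ * (κ m * V (t₁ m))
    first-term m j<n = R₂.begin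
      N * (q ^ e₁ m * b j)
        R₂.≈⟨ Mod².≈⇒≋ (*-congˡ (*-congʳ (trans (^-congʳ q (e₁-tri m)) (^-homo-* q (3 ℕ.* T) (tri j))))) ⟩
      N * (q ^ (3 ℕ.* T) * q ^ tri j * b j)
        R₂.≈⟨ Mod².≈⇒≋ (trans (solve 4 (λ n x y z → n :* (x :* y :* z) := x :* (n :* (y :* z))) refl _ _ _ _)
            (*-congʳ (sym (^-assocʳ q 3 T)))) ⟩
      y ^ T * (N * a j)
        R₂.≈⟨ R₂.*-congˡ (N*a (3 ℕ.* m) j<n) ⟩
      y ^ T * ((- 1#) ^ (3 ℕ.* m) * δ * V (t₁ m))
        R₂.≈⟨ Mod².≈⇒≋ (*-congˡ (*-congʳ (*-congʳ (-1^[3*m] m)))) ⟩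
      y ^ T * ((- 1#) ^ m * δ * V (t₁ m))
        R₂.≈⟨ Mod².≈⇒≋ (solve 4 (λ y s d v → y :* (s :* d :* v) := d :* (s :* y :* v)) refl _ _ _ _) ⟩
      δ * (κ m * V (t₁ m)) R₂.∎
      where
      j = 1 ℕ.+ 3 ℕ.* m
      T = tri (suc m)

    second-term : ∀ m → 2 ℕ.+ 3 ℕ.* m < n →
      N * (q ^ e₂ m * b (2 ℕ.+ 3 ℕ.* m)) ≈₂ - (δ * (κ m * (t₂ m * V (t₂ m))))
    second-term m j<n = R₂.begin
      N * (q ^ e₂ m * b j)
        R₂.≈⟨ Mod².≈⇒≋ (*-congˡ (*-congʳ (trans (^-congʳ q (e₂-tri m))
            (trans (^-homo-* q (3 ℕ.* T) (j ℕ.+ tri j)) (*-congˡ (^-homo-* q j (tri j))))))) ⟩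
      N * (q ^ (3 ℕ.* T) * (t₂ m * q ^ tri j) * b j)
        R₂.≈⟨ Mod².≈⇒≋ (trans (solve 5 (λ n x t y z → n :* (x :* (t :* y) :* z) := x :* t :* (n :* (y :* z)))
            refl _ _ _ _ _) (*-congʳ (*-congʳ (sym (^-assocʳ q 3 T))))) ⟩
      y ^ T * t₂ m * (N * a j)
        R₂.≈⟨ R₂.*-congˡ (N*a (1 ℕ.+ 3 ℕ.* m) j<n) ⟩
      y ^ T * t₂ m * (- 1# * (- 1#) ^ (3 ℕ.* m) * δ * V (t₂ m))
        R₂.≈⟨ Mod².≈⇒≋ (*-congˡ (*-congʳ (*-congʳ (*-congˡ (-1^[3*m] m))))) ⟩
      y ^ T * t₂ m * (- 1# * (- 1#) ^ m * δ * V (t₂ m))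
        R₂.≈⟨ Mod².≈⇒≋ (solve 5 (λ y t s d v → y :* t :* (:- con (+ 1) :* s :* d :* v) := :-
            (d :* (s :* y :* (t :* v)))) refl _ _ _ _ _) ⟩
      - (δ * (κ m * (t₂ m * V (t₂ m)))) R₂.∎
      where
      j = 2 ℕ.+ 3 ℕ.* m
      T = tri (suc m)

    N*partialTheta : ∀ r → 3 ℕ.* r ≤ n → N * ∑ r (partialTheta n) ≈₂ δ * Y r
    N*partialTheta r 3r≤n = R₂.begin
      N * ∑ r (partialTheta n)              R₂.≈⟨ Mod².≈⇒≋ (∑-* r N (partialTheta n)) ⟨
      ∑ r (λ m → N * partialTheta n m)      R₂.≈⟨ R₂.∑-cong r (λ m m<r → term m (ℕP.≤-trans (bound m m<r) 3r≤n)) ⟩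
      ∑ r (λ m → δ * (κ m * (V (t₁ m) + t₂ m * V (t₂ m)))) R₂.≈⟨ Mod².≈⇒≋ (∑-* r δ _) ⟩
      δ * Y r                               R₂.∎
      where
      bound : ∀ m → m < r → 3 ℕ.+ 3 ℕ.* m ≤ 3 ℕ.* r
      bound m m<r = ≡.subst (_≤ 3 ℕ.* r) (ℕP.*-suc 3 m) (ℕP.*-monoʳ-≤ 3 m<r)
      term : ∀ m → 2 ℕ.+ 3 ℕ.* m < n → N * partialTheta n m ≈₂ δ * (κ m * (V (t₁ m) + t₂ m * V (t₂ m)))
      term m j<n = R₂.begin
        N * partialTheta n m
          R₂.≈⟨ Mod².≈⇒≋ (solve 3 (λ n u v → n :* (u :- v) := n :* u :- n :* v) refl _ _ _) ⟩
        N * (q ^ e₁ m * b (1 ℕ.+ 3 ℕ.* m)) - N * (q ^ e₂ m * b (2 ℕ.+ 3 ℕ.* m))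
          R₂.≈⟨ R₂.+-cong (first-term m (ℕP.<⇒≤ j<n)) (R₂.-‿cong (second-term m j<n)) ⟩
        δ * (κ m * V (t₁ m)) - - (δ * (κ m * (t₂ m * V (t₂ m))))
          R₂.≈⟨ Mod².≈⇒≋ (solve 4 (λ d k u v → d :* (k :* u) :- :- (d :* (k :* v)) := d :* (k :* (u :+ v)))
              refl _ _ _ _) ⟩
        δ * (κ m * (V (t₁ m) + t₂ m * V (t₂ m))) R₂.∎

    δ* : ∀ u → δ * u ≈ ε * (u + u)
    δ* u = solve 2 (λ e u → e :* (con (+ 1) :+ con (+ 1)) :* u := e :* (u :+ u)) refl ε u

    -- The geometric sum of q^n has r terms, each 1 modulo φ, and ε supplies the second factor φ.
    1-q^[n*r] : ∀ r → 1# - q ^ (n ℕ.* r) ≈₂ ε * r ·1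
    1-q^[n*r] r = R₂.begin
      1# - q ^ (n ℕ.* r)      R₂.≈⟨ Mod².≈⇒≋ (+-congˡ (-‿cong (sym (^-assocʳ q n r)))) ⟩
      1# - (q ^ n) ^ r        R₂.≈⟨ Mod².≈⇒≋ (geometric r (q ^ n)) ⟨
      ε * [ r ] (q ^ n)       R₂.≈⟨ *-lift ε≈₁0 (R₁.∑-cong r (λ i _ → R₁.^-≡1 i q^n≈1)) ⟩
      ε * r ·1                R₂.∎

    S : Carrier
    S = ∑ n (λ k → q ^ k * G (k ℕ.+ k) k)

    S-0-mod-3 : ∀ r → n ≡ 3 ℕ.* r → N * S ≈₂ 0#
    S-0-mod-3 r n≡3r = R₂.begin
      N * S                           R₂.≈⟨ Mod².≈⇒≋ (*-congˡ (central-sum r n (ℕP.≤-reflexive n≡3r))) ⟩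
      N * ∑ r (partialTheta n)        R₂.≈⟨ N*partialTheta r (ℕP.≤-reflexive (≡.sym n≡3r)) ⟩
      δ * Y r                         R₂.≈⟨ Mod².≈⇒≋ (δ* (Y r)) ⟩
      ε * (Y r + Y r)                 R₂.≈⟨ *-lift-0 ε≈₁0 (R₁.trans
          (R₁.+-cong (Y-0-mod-3 r n≡3r) (Y-0-mod-3 r n≡3r)) (R₁.+-identityʳ _)) ⟩
      0#                              R₂.∎

    b-top : ∀ {j} → j ≡ n → b j ≈ 1#
    b-top ≡.refl = G-diag (n ℕ.+ n)

    b-beyond : ∀ {j} → n < j → b j ≈ 0#
    b-beyond n<j = G-zero (ℕP.+-monoʳ-< n n<j)

    module _ (coprime : ∀ i → n ∣ 3 ℕ.* i → n ∣ i) where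

      -- Block r is reduced to its term j = n, which is q^(e + nr). It differs from q^e by -q^e (1 -
      -- q^(nr)), which modulo φ² is -r ε q^e; the doubled Appell sum contributes the opposite
      -- amount.
      S-1-mod-3 : ∀ r e → n ≡ 1 ℕ.+ 3 ℕ.* r → e ≡ r ℕ.+ n ℕ.* r → N * (S - q ^ e) ≈₂ 0#
      S-1-mod-3 r e n≡1+3r e≡ = R₂.begin
        N * (S - q ^ e)
          R₂.≈⟨ Mod².≈⇒≋ (*-congˡ (+-congʳ (trans (central-sum (suc r) n n≤3+3r) (+-congˡ last)))) ⟩
        N * (∑ r (partialTheta n) + q ^ (e ℕ.+ n ℕ.* r) - q ^ e)
          R₂.≈⟨ Mod².≈⇒≋ (trans (*-congˡ (+-congʳ (+-congˡ (^-homo-* q e (n ℕ.* r)))))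
                 (solve 4 (λ n p u v → n :* (p :+ u :* v :- u) := n :* p :- n :* u :* (con (+ 1) :- v)) refl N _
                     (q ^ e) (q ^ (n ℕ.* r)))) ⟩
        N * ∑ r (partialTheta n) - N * q ^ e * (1# - q ^ (n ℕ.* r))
          R₂.≈⟨ R₂.+-cong (N*partialTheta r 3r≤n) (R₂.-‿cong (R₂.*-congˡ (1-q^[n*r] r))) ⟩
        δ * Y r - N * q ^ e * (ε * r ·1)
          R₂.≈⟨ Mod².≈⇒≋ (+-cong (δ* (Y r)) (solve 4 (λ n u v w → :- (n :* u :* (v :* w)) := v :*
              (:- (u :* (w :* n)))) refl _ _ _ _)) ⟩
        ε * (Y r + Y r) + ε * - (q ^ e * (r ·1 * N))
          R₂.≈⟨ Mod².≈⇒≋ (distribˡ ε _ _) ⟨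
        ε * (Y r + Y r - q ^ e * (r ·1 * N))
          R₂.≈⟨ *-lift-0 ε≈₁0 (R₁.trans (R₁.+-congʳ (R₁.trans (2Y-1-mod-3 coprime r n≡1+3r)
              (R₁.*-congʳ (R₁.trans (κ-1-mod-3 r n≡1+3r) (R₁.sym q^e≈q^r))))) (R₁.-‿inverseʳ _)) ⟩
        0# R₂.∎
        where
        n≤3+3r : n ≤ 3 ℕ.* suc r
        n≤3+3r = ≡.subst₂ _≤_ (≡.sym n≡1+3r) (≡.sym (ℕP.*-suc 3 r)) (s≤s (ℕP.m≤n+m _ 2))
        3r≤n : 3 ℕ.* r ≤ n
        3r≤n = ≡.subst (3 ℕ.* r ≤_) (≡.sym n≡1+3r) (ℕP.n≤1+n _)
        exponent : e₁ r ≡ e ℕ.+ n ℕ.* r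
        exponent = ≡.trans (lem r) (≡.trans (≡.cong (λ k → r ℕ.+ k ℕ.* r ℕ.+ k ℕ.* r) (≡.sym n≡1+3r))
            (≡.cong (ℕ._+ n ℕ.* r) (≡.sym e≡)))
          where
          lem : ∀ r → 6 ℕ.* (r ℕ.* r) ℕ.+ 3 ℕ.* r ≡ r ℕ.+ (1 ℕ.+ 3 ℕ.* r) ℕ.* r ℕ.+ (1 ℕ.+ 3 ℕ.* r) ℕ.* r
          lem = solve-∀
        last : partialTheta n r ≈ q ^ (e ℕ.+ n ℕ.* r)
        last = trans (+-cong (*-cong (^-congʳ q exponent) (b-top (≡.sym n≡1+3r)))
                             (-‿cong (*-congˡ (b-beyond (≡.subst (_< 2 ℕ.+ 3 ℕ.* r) (≡.sym n≡1+3r) (ℕP.n<1+n _))))))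
          (solve 2 (λ u v → u :* con (+ 1) :- v :* con (+ 0) := u) refl _ _)
        q^e≈q^r : q ^ e ≈₁ q ^ r
        q^e≈q^r = R₁.trans (R₁.^-congʳ q e≡) (R₁.trans (R₁.^-homo-* q r (n ℕ.* r))
          (R₁.trans (R₁.*-congˡ (q^[n*k]≈1 r)) (R₁.*-identityʳ _)))

      -- Block r now contains an ordinary term, j = n - 1, which joins the Appell sum, and the term
      -- j = -n, equal to -q^(e + n(r+1)). The condition on e expresses e = (n - 1)(r + 1) without
      -- subtraction.
      S-2-mod-3 : ∀ r e → n ≡ 2 ℕ.+ 3 ℕ.* r → e ℕ.+ suc r ≡ n ℕ.* suc r → N * (S + q ^ e) ≈₂ 0#
      S-2-mod-3 r e n≡2+3r e≡ = R₂.begin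
        N * (S + q ^ e)
          R₂.≈⟨ Mod².≈⇒≋ (*-congˡ (+-congʳ (trans (central-sum (suc r) n n≤3+3r) (+-congˡ last)))) ⟩
        N * (∑ r (partialTheta n) + (q ^ e₁ r * b (1 ℕ.+ 3 ℕ.* r) - q ^ (e ℕ.+ n ℕ.* suc r)) + q ^ e)
          R₂.≈⟨ Mod².≈⇒≋ (trans (*-congˡ (+-congʳ (+-congˡ (+-congˡ (-‿cong (^-homo-* q e (n ℕ.* suc r)))))))
                 (solve 5 (λ n p w u v → n :* (p :+ (w :- u :* v) :+ u) := n :* p :+ n :* w :+ n :* u :*
                     (con (+ 1) :- v)) refl N _ _ (q ^ e) (q ^ (n ℕ.* suc r)))) ⟩
        N * ∑ r (partialTheta n) + N * (q ^ e₁ r * b (1 ℕ.+ 3 ℕ.* r)) + N * q ^ e * (1# - q ^ (n ℕ.* suc r))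
          R₂.≈⟨ R₂.+-cong (R₂.+-cong (N*partialTheta r 3r≤n) (first-term r j<n)) (R₂.*-congˡ (1-q^[n*r] (suc r))) ⟩
        δ * Y r + δ * (κ r * V (t₁ r)) + N * q ^ e * (ε * suc r ·1)
          R₂.≈⟨ Mod².≈⇒≋ (+-cong (trans (sym (distribˡ δ _ _)) (δ* X))
              (solve 4 (λ n u v w → n :* u :* (v :* w) := v :* (u :* (w :* n))) refl _ _ _ _)) ⟩
        ε * (X + X) + ε * (q ^ e * (suc r ·1 * N))
          R₂.≈⟨ Mod².≈⇒≋ (distribˡ ε _ _) ⟨
        ε * (X + X + q ^ e * (suc r ·1 * N))
          R₂.≈⟨ *-lift-0 ε≈₁0 (R₁.trans (R₁.+-cong (2X-2-mod-3 coprime r n≡2+3r) (R₁.*-congʳ q^e≈-κ))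
              (Mod.≈⇒≋ (solve 2 (λ k v → k :* v :+ :- k :* v := con (+ 0)) refl _ _))) ⟩
        0# R₂.∎
        where
        X = Y r + κ r * V (t₁ r)
        n≤3+3r : n ≤ 3 ℕ.* suc r
        n≤3+3r = ≡.subst₂ _≤_ (≡.sym n≡2+3r) (≡.sym (ℕP.*-suc 3 r)) (ℕP.n≤1+n _)
        3r≤n : 3 ℕ.* r ≤ n
        3r≤n = ≡.subst (3 ℕ.* r ≤_) (≡.sym n≡2+3r) (ℕP.m≤n+m _ 2)
        j<n : 1 ℕ.+ 3 ℕ.* r < n
        j<n = ≡.subst (1 ℕ.+ 3 ℕ.* r <_) (≡.sym n≡2+3r) (ℕP.n<1+n _)
        exponent : e₂ r ≡ e ℕ.+ n ℕ.* suc r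
        exponent = ℕP.+-cancelʳ-≡ (suc r) _ _ (≡.trans (lem r)
            (≡.trans (≡.cong (λ k → k ℕ.* suc r ℕ.+ k ℕ.* suc r) (≡.sym n≡2+3r))
          (≡.trans (≡.cong (ℕ._+ n ℕ.* suc r) (≡.sym e≡)) (swap e (suc r) (n ℕ.* suc r)))))
          where
          lem : ∀ r → 6 ℕ.* (r ℕ.* r) ℕ.+ 9 ℕ.* r ℕ.+ 3 ℕ.+ (1 ℕ.+ r) ≡ (2 ℕ.+ 3 ℕ.* r) ℕ.* (1 ℕ.+ r) ℕ.+
              (2 ℕ.+ 3 ℕ.* r) ℕ.* (1 ℕ.+ r)
          lem = solve-∀
          swap : ∀ u v w → u ℕ.+ v ℕ.+ w ≡ u ℕ.+ w ℕ.+ v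
          swap = solve-∀
        last : partialTheta n r ≈ q ^ e₁ r * b (1 ℕ.+ 3 ℕ.* r) - q ^ (e ℕ.+ n ℕ.* suc r)
        last = +-congˡ (-‿cong (trans (*-cong (^-congʳ q exponent) (b-top (≡.sym n≡2+3r))) (*-identityʳ _)))
        q^e≈-κ : q ^ e ≈₁ - κ r
        q^e≈-κ = inverse-unique
          (R₁.trans (R₁.sym (R₁.^-homo-* q e (suc r))) (R₁.trans (R₁.^-congʳ q e≡) (q^[n*k]≈1 (suc r))))
          (R₁.trans (Mod.≈⇒≋ (solve 2 (λ k u → :- k :* u := :- (k :* u)) refl _ _))
            (R₁.trans (R₁.-‿cong (κ-2-mod-3 r n≡2+3r)) (Mod.≈⇒≋ (solve 0 (:- :- con (+ 1) := con (+ 1)) refl))))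

-- Why q is a regular root of unity modulo a cyclotomic polynomial.

module CyclotomicFactor
  (R : CommutativeRing 0ℓ 0ℓ) (n′ : ℕ) (q φ D : CommutativeRing.Carrier R) where
  open Arithmetic R
  open Quotient R φ
  module R₁ = Arithmetic quotient

  private
    n = suc n′

  module _ (φD≈q^n-1 : φ * D ≈ q ^ n - 1#)
           (D-factor : ∀ d → suc d ∣ n → suc d < n → ∃ λ w → D ≈ (q ^ suc d - 1#) * w)
           (q^-regular : ∀ d {a} → (q ^ suc d - 1#) * a ≈ 0# → a ≈ 0#)
           (ℤ-regular : ∀ k {a} → suc k ·1 * a ≋ 0# → a ≋ 0#) where

    q^n≋1 : q ^ n ≋ 1#
    q^n≋1 = D , trans (solve 1 (λ u → u := con (+ 1) :+ (u :- con (+ 1))) refl _) (+-congˡ (sym φD≈q^n-1))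

    fixed-^ : ∀ {t a} → t * a ≋ a → ∀ k → t ^ k * a ≋ a
    fixed-^         h zero    = R₁.*-identityˡ _
    fixed-^ {t} {a} h (suc k) = R₁.trans (R₁.*-assoc t (t ^ k) a) (R₁.trans (R₁.*-congˡ (fixed-^ h k)) h)

    q^-exchange : ∀ g j v k u → g ℕ.+ v ℕ.* j ≡ u ℕ.* k → q ^ g * (q ^ j) ^ v ≈ (q ^ k) ^ u
    q^-exchange g j v k u e = trans (*-congˡ (trans (^-assocʳ q j v) (^-congʳ q (ℕP.*-comm j v))))
      (trans (sym (^-homo-* q g (v ℕ.* j))) (trans (^-congʳ q (≡.trans e (ℕP.*-comm u k))) (sym (^-assocʳ q k u))))

    fixed-n : ∀ a → q ^ n * a ≋ a
    fixed-n a = R₁.trans (R₁.*-congʳ q^n≋1) (R₁.*-identityˡ a)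

    -- Bézout writes the gcd as a difference of multiples of k and n. The subtracted multiple is
    -- inserted as a power fixing a, so all exponents remain natural numbers.
    fixed-gcd : ∀ k {a} → q ^ k * a ≋ a → q ^ gcd k n * a ≋ a
    fixed-gcd k {a} h with Bézout.identity (gcd-GCD k n)
    ... | Bézout.+- u v e = R₁.begin
      q ^ gcd k n * a                   R₁.≈⟨ R₁.*-congˡ (fixed-^ (fixed-n a) v) ⟨
      q ^ gcd k n * ((q ^ n) ^ v * a)   R₁.≈⟨ ≈⇒≋ (trans (sym (*-assoc _ _ _))
          (*-congʳ (q^-exchange (gcd k n) n v k u e))) ⟩
      (q ^ k) ^ u * a             R₁.≈⟨ fixed-^ h u ⟩
      a                           R₁.∎
    ... | Bézout.-+ u v e = R₁.begin
      q ^ gcd k n * a                   R₁.≈⟨ R₁.*-congˡ (fixed-^ h u) ⟨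
      q ^ gcd k n * ((q ^ k) ^ u * a)   R₁.≈⟨ ≈⇒≋ (trans (sym (*-assoc _ _ _))
          (*-congʳ (q^-exchange (gcd k n) k u n v e))) ⟩
      (q ^ n) ^ v * a             R₁.≈⟨ fixed-^ (fixed-n a) v ⟩
      a                           R₁.∎

    -- As (q^d - 1) φ divides q^n - 1, the geometric sum (q^n - 1) / (q^d - 1) vanishes modulo φ; on an
    -- element fixed by q^d it acts as the integer n / d.
    fixed-divisor : ∀ d → suc d ∣ n → suc d < n → ∀ {a} → q ^ suc d * a ≋ a → a ≋ 0#
    fixed-divisor d d∣n@(divides (suc e) n≡ed) d<n {a} h = ℤ-regular e (R₁.begin
      suc e ·1 * a                     R₁.≈⟨ R₁.*-comm _ _ ⟩
      a * suc e ·1                     R₁.≈⟨ R₁.∑-* (suc e) a (λ _ → 1#) ⟨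
      R₁.∑ (suc e) (λ _ → a * 1#)      R₁.≈⟨ R₁.∑-cong (suc e)
          (λ i _ → R₁.trans (R₁.*-identityʳ a) (R₁.trans (R₁.sym (fixed-^ h i)) (R₁.*-comm _ _))) ⟩
      R₁.∑ (suc e) (λ i → a * t ^ i)   R₁.≈⟨ R₁.∑-* (suc e) a (t ^_) ⟩
      a * [ suc e ] t                  R₁.≈⟨ R₁.*-congˡ (proj₁ (D-factor d d∣n d<n) , trans
          (x-y≈0⇒x≈y (q^-regular d quotient≈)) (sym (+-identityˡ _))) ⟩
      a * 0#                           R₁.≈⟨ R₁.zeroʳ a ⟩
      0#                               R₁.∎)
      where
      t = q ^ suc d
      w = proj₁ (D-factor d d∣n d<n)
      quotient≈ : (t - 1#) * ([ suc e ] t - φ * w) ≈ 0#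
      quotient≈ = begin
        (t - 1#) * ([ suc e ] t - φ * w)
          ≈⟨ solve 4 (λ t s f w → (t :- con (+ 1)) :* (s :- f :* w) := :- ((con (+ 1) :- t) :* s) :- f :*
              ((t :- con (+ 1)) :* w)) refl t _ φ w ⟩
        - ((1# - t) * [ suc e ] t) - φ * ((t - 1#) * w)
          ≈⟨ +-cong (-‿cong (trans (geometric (suc e) t) (+-congˡ
              (-‿cong (trans (^-assocʳ q (suc d) (suc e)) (^-congʳ q
              (≡.trans (ℕP.*-comm (suc d) (suc e)) (≡.sym n≡ed))))))))
                    (-‿cong (trans (*-congˡ (sym (proj₂ (D-factor d d∣n d<n)))) φD≈q^n-1)) ⟩
        - (1# - q ^ n) - (q ^ n - 1#)
          ≈⟨ solve 1 (λ u → :- (con (+ 1) :- u) :- (u :- con (+ 1)) := con (+ 0)) refl _ ⟩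
        0# ∎

    regularRoot : RegularRoot quotient n q
    regularRoot = record { q^n≈1 = q^n≋1 ; q-regular = regular }
      where
      regular : ∀ k → n ∤ k → ∀ {a} → q ^ k * a ≋ a → a ≋ 0#
      regular k n∤k {a} h = go (gcd k n) ≡.refl
        where
        go : ∀ g → gcd k n ≡ g → a ≋ 0#
        go zero    e with ≡.subst (_∣ n) e (gcd[m,n]∣n k n)
        ... | divides c n≡c*0 = contradiction (≡.trans n≡c*0 (ℕP.*-zeroʳ c)) (λ ())
        go (suc d) e = fixed-divisor d d∣n (ℕP.≤∧≢⇒< (∣⇒≤ d∣n)
            (λ d≡n → n∤k (≡.subst (_∣ k) (≡.trans e d≡n) (gcd[m,n]∣m k n))))
          (≡.subst (λ g → q ^ g * a ≋ a) e (fixed-gcd k h))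
          where
          d∣n : suc d ∣ n
          d∣n = ≡.subst (_∣ n) e (gcd[m,n]∣n k n)

-- The relation _≈_ unfolds to a function type, from which Agda cannot recover the two polynomials.
infix 4 _≐_
record _≐_ (p q : Poly) : Set where
  constructor ext
  field at : p Defs.≈ q
open _≐_

-- The ring of integer polynomials and cancellation in it.

module Polynomials where
  refl : ∀ {p} → p ≐ p
  refl = ext (λ _ → ≡.refl)

  sym : ∀ {p q} → p ≐ q → q ≐ p
  sym h = ext (λ i → ≡.sym (at h i))

  trans : ∀ {p q r} → p ≐ q → q ≐ r → p ≐ r
  trans h h′ = ext (λ i → ≡.trans (at h i) (at h′ i))

  scale : ℤ → Poly → Poly
  scale a = map (a ℤ.*_)

  coeff-⊕ : ∀ p q i → coeff (p ⊕ q) i ≡ coeff p i ℤ.+ coeff q i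
  coeff-⊕ []      q       i       = ≡.sym (ℤP.+-identityˡ _)
  coeff-⊕ (a ∷ p) []      i       = ≡.sym (ℤP.+-identityʳ _)
  coeff-⊕ (a ∷ p) (b ∷ q) zero    = ≡.refl
  coeff-⊕ (a ∷ p) (b ∷ q) (suc i) = coeff-⊕ p q i

  coeff-neg : ∀ p i → coeff (neg p) i ≡ ℤ.- coeff p i
  coeff-neg []      i       = ≡.refl
  coeff-neg (a ∷ p) zero    = ≡.refl
  coeff-neg (a ∷ p) (suc i) = coeff-neg p i

  coeff-scale : ∀ a p i → coeff (scale a p) i ≡ a ℤ.* coeff p i
  coeff-scale a []      i       = ≡.sym (ℤP.*-zeroʳ a)
  coeff-scale a (b ∷ p) zero    = ≡.refl
  coeff-scale a (b ∷ p) (suc i) = coeff-scale a p i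

  ⊕-cong : ∀ {p p′ q q′} → p ≐ p′ → q ≐ q′ → p ⊕ q ≐ p′ ⊕ q′
  ⊕-cong {p} {p′} {q} {q′} h h′ = ext λ i → ≡.trans (coeff-⊕ p q i)
    (≡.trans (≡.cong₂ ℤ._+_ (at h i) (at h′ i)) (≡.sym (coeff-⊕ p′ q′ i)))

  ⊕-comm : ∀ p q → p ⊕ q ≐ q ⊕ p
  ⊕-comm p q = ext λ i → ≡.trans (coeff-⊕ p q i) (≡.trans (ℤP.+-comm (coeff p i) _) (≡.sym (coeff-⊕ q p i)))

  ⊕-congˡ : ∀ p {q q′} → q ≐ q′ → p ⊕ q ≐ p ⊕ q′
  ⊕-congˡ p h = ⊕-cong (refl {p}) h

  ⊕-congʳ : ∀ q {p p′} → p ≐ p′ → p ⊕ q ≐ p′ ⊕ q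
  ⊕-congʳ q h = ⊕-cong h (refl {q})

  ⊕-assoc : ∀ p q r → p ⊕ q ⊕ r ≐ p ⊕ (q ⊕ r)
  ⊕-assoc p q r = ext λ i → ≡.trans (coeff-⊕ (p ⊕ q) r i) (≡.trans (≡.cong (ℤ._+ coeff r i) (coeff-⊕ p q i))
    (≡.trans (ℤP.+-assoc (coeff p i) _ _)
    (≡.sym (≡.trans (coeff-⊕ p (q ⊕ r) i) (≡.cong (λ z → coeff p i ℤ.+ z) (coeff-⊕ q r i))))))

  ⊕-identityʳ : ∀ p → p ⊕ [] ≐ p
  ⊕-identityʳ p = ⊕-comm p []

  neg-cong : ∀ {p q} → p ≐ q → neg p ≐ neg q
  neg-cong {p} {q} h = ext λ i → ≡.trans (coeff-neg p i) (≡.trans (≡.cong ℤ.-_ (at h i)) (≡.sym (coeff-neg q i)))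

  ⊕-inverseʳ : ∀ p → p ⊕ neg p ≐ []
  ⊕-inverseʳ p = ext λ i → ≡.trans (coeff-⊕ p (neg p) i)
    (≡.trans (≡.cong (λ z → coeff p i ℤ.+ z) (coeff-neg p i)) (ℤP.+-inverseʳ (coeff p i)))

  ⊖-congʳ : ∀ p {q q′} → q ≐ q′ → p ⊖ q ≐ p ⊖ q′
  ⊖-congʳ p h = ⊕-congˡ p (neg-cong h)

  ⊕-swap : ∀ p q r → p ⊕ (q ⊕ r) ≐ q ⊕ (p ⊕ r)
  ⊕-swap p q r = trans (sym (⊕-assoc p q r)) (trans (⊕-cong (⊕-comm p q) refl) (⊕-assoc q p r))

  ⊕-interchange : ∀ p q r s → p ⊕ q ⊕ (r ⊕ s) ≐ p ⊕ r ⊕ (q ⊕ s)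
  ⊕-interchange p q r s = trans (⊕-assoc p q (r ⊕ s))
    (trans (⊕-cong (refl {p}) (⊕-swap q r s)) (sym (⊕-assoc p r (q ⊕ s))))

  ∷-cong : ∀ {a b p q} → a ≡ b → p ≐ q → a ∷ p ≐ b ∷ q
  ∷-cong e h = ext λ { zero → e ; (suc i) → at h i }

  0∷[]≐[] : + 0 ∷ [] ≐ []
  0∷[]≐[] = ext λ { zero → ≡.refl ; (suc i) → ≡.refl }

  scale-cong : ∀ {a b p q} → a ≡ b → p ≐ q → scale a p ≐ scale b q
  scale-cong {a} {b} {p} {q} e h = ext λ i →
    ≡.trans (coeff-scale a p i) (≡.trans (≡.cong₂ ℤ._*_ e (at h i)) (≡.sym (coeff-scale b q i)))

  scale-⊕ : ∀ a p q → scale a (p ⊕ q) ≐ scale a p ⊕ scale a q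
  scale-⊕ a p q = ext λ i → ≡.trans (coeff-scale a (p ⊕ q) i) (≡.trans (≡.cong (a ℤ.*_) (coeff-⊕ p q i))
    (≡.trans (ℤP.*-distribˡ-+ a (coeff p i) _)
    (≡.sym (≡.trans (coeff-⊕ (scale a p) (scale a q) i) (≡.cong₂ ℤ._+_ (coeff-scale a p i) (coeff-scale a q i))))))

  scale-+ : ∀ a b p → scale (a ℤ.+ b) p ≐ scale a p ⊕ scale b p
  scale-+ a b p = ext λ i → ≡.trans (coeff-scale (a ℤ.+ b) p i) (≡.trans (ℤP.*-distribʳ-+ (coeff p i) a b)
    (≡.sym (≡.trans (coeff-⊕ (scale a p) (scale b p) i) (≡.cong₂ ℤ._+_ (coeff-scale a p i) (coeff-scale b p i)))))

  scale-scale : ∀ a b p → scale (a ℤ.* b) p ≐ scale a (scale b p)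
  scale-scale a b p = ext λ i → ≡.trans (coeff-scale (a ℤ.* b) p i) (≡.trans (ℤP.*-assoc a b _)
    (≡.sym (≡.trans (coeff-scale a (scale b p) i) (≡.cong (a ℤ.*_) (coeff-scale b p i)))))

  scale-0 : ∀ p → scale (+ 0) p ≐ []
  scale-0 p = ext (coeff-scale (+ 0) p)

  scale-1 : ∀ p → scale (+ 1) p ≐ p
  scale-1 p = ext λ i → ≡.trans (coeff-scale (+ 1) p i) (ℤP.*-identityˡ _)

  ⊗-congˡ : ∀ p {q q′} → q ≐ q′ → p ⊗ q ≐ p ⊗ q′
  ⊗-congˡ []      h = refl
  ⊗-congˡ (a ∷ p) h = ⊕-cong (scale-cong {a} ≡.refl h) (∷-cong ≡.refl (⊗-congˡ p h))

  ⊗-zeroʳ : ∀ p → p ⊗ [] ≐ []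
  ⊗-zeroʳ []      = refl
  ⊗-zeroʳ (a ∷ p) = trans (∷-cong ≡.refl (⊗-zeroʳ p)) 0∷[]≐[]

  ⊗-∷ʳ : ∀ p b q → p ⊗ (b ∷ q) ≐ scale b p ⊕ (+ 0 ∷ (p ⊗ q))
  ⊗-∷ʳ []      b q = sym 0∷[]≐[]
  ⊗-∷ʳ (a ∷ p) b q = ∷-cong (≡.cong (ℤ._+ + 0) (ℤP.*-comm a b))
    (trans (⊕-cong refl (⊗-∷ʳ p b q)) (⊕-swap (scale a q) (scale b p) _))

  ⊗-comm : ∀ p q → p ⊗ q ≐ q ⊗ p
  ⊗-comm []      q = sym (⊗-zeroʳ q)
  ⊗-comm (a ∷ p) q = trans (⊕-cong refl (∷-cong ≡.refl (⊗-comm p q))) (sym (⊗-∷ʳ q a p))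

  ⊗-congʳ : ∀ q {p p′} → p ≐ p′ → p ⊗ q ≐ p′ ⊗ q
  ⊗-congʳ q {p} {p′} h = trans (⊗-comm p q) (trans (⊗-congˡ q h) (⊗-comm q p′))

  ⊗-cong : ∀ {p p′ q q′} → p ≐ p′ → q ≐ q′ → p ⊗ q ≐ p′ ⊗ q′
  ⊗-cong {p} {p′} {q} {q′} h h′ = trans (⊗-congʳ q h) (⊗-congˡ p′ h′)

  ⊗-distribʳ : ∀ r p q → (p ⊕ q) ⊗ r ≐ (p ⊗ r) ⊕ (q ⊗ r)
  ⊗-distribʳ r []      q       = refl
  ⊗-distribʳ r (a ∷ p) []      = sym (⊕-identityʳ ((a ∷ p) ⊗ r))
  ⊗-distribʳ r (a ∷ p) (b ∷ q) = trans
    (⊕-cong (scale-+ a b r) (∷-cong {+ 0} ≡.refl (⊗-distribʳ r p q)))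
    (⊕-interchange (scale a r) (scale b r) (+ 0 ∷ (p ⊗ r)) (+ 0 ∷ (q ⊗ r)))

  ⊗-distribˡ : ∀ r p q → r ⊗ (p ⊕ q) ≐ (r ⊗ p) ⊕ (r ⊗ q)
  ⊗-distribˡ r p q = trans (⊗-comm r (p ⊕ q)) (trans (⊗-distribʳ r p q) (⊕-cong (⊗-comm p r) (⊗-comm q r)))

  scale-⊗ : ∀ a p q → scale a p ⊗ q ≐ scale a (p ⊗ q)
  scale-⊗ a []      q = refl
  scale-⊗ a (b ∷ p) q = trans (⊕-cong (scale-scale a b q) (∷-cong (≡.sym (ℤP.*-zeroʳ a)) (scale-⊗ a p q)))
    (sym (scale-⊕ a (scale b q) (+ 0 ∷ (p ⊗ q))))

  0∷-⊗ : ∀ p q → (+ 0 ∷ p) ⊗ q ≐ + 0 ∷ (p ⊗ q)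
  0∷-⊗ p q = ⊕-cong (scale-0 q) refl

  ⊗-assoc : ∀ p q r → (p ⊗ q) ⊗ r ≐ p ⊗ (q ⊗ r)
  ⊗-assoc []      q r = refl
  ⊗-assoc (a ∷ p) q r = trans (⊗-distribʳ r (scale a q) (+ 0 ∷ (p ⊗ q)))
    (⊕-cong (scale-⊗ a q r) (trans (0∷-⊗ (p ⊗ q) r) (∷-cong ≡.refl (⊗-assoc p q r))))

  C⊗ : ∀ a p → C a ⊗ p ≐ scale a p
  C⊗ a p = trans (⊕-cong refl 0∷[]≐[]) (⊕-identityʳ (scale a p))

  ⊗-identityˡ : ∀ p → one ⊗ p ≐ p
  ⊗-identityˡ p = trans (C⊗ (+ 1) p) (scale-1 p)

  polyRing : CommutativeRing 0ℓ 0ℓ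
  polyRing = record
    { Carrier = Poly ; _≈_ = _≐_ ; _+_ = _⊕_ ; _*_ = _⊗_ ; -_ = neg ; 0# = [] ; 1# = one
    ; isCommutativeRing = record
      { isRing = record
        { +-isAbelianGroup = record
          { isGroup = record
            { isMonoid = record
              { isSemigroup = record
                { isMagma = record { isEquivalence = record { refl = refl ; sym = sym ; trans = trans } ; ∙-cong =
                    ⊕-cong }
                ; assoc = ⊕-assoc }
              ; identity = (λ p → refl) , ⊕-identityʳ }
            ; inverse = (λ p → trans (⊕-comm (neg p) p) (⊕-inverseʳ p)) , ⊕-inverseʳ
            ; ⁻¹-cong = neg-cong }
          ; comm = ⊕-comm }
        ; *-cong = ⊗-cong
        ; *-assoc = ⊗-assoc
        ; *-identity = ⊗-identityˡ , λ p → trans (⊗-comm p one) (⊗-identityˡ p)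
        ; distrib = ⊗-distribˡ , ⊗-distribʳ }
      ; *-comm = ⊗-comm } }

  coeff-C⊗ : ∀ a p i → coeff (C a ⊗ p) i ≡ a ℤ.* coeff p i
  coeff-C⊗ a p i = ≡.trans (at (C⊗ a p) i) (coeff-scale a p i)

  constant-⊗ : ∀ p q → coeff (p ⊗ q) 0 ≡ coeff p 0 ℤ.* coeff q 0
  constant-⊗ []      q = ≡.refl
  constant-⊗ (a ∷ p) q = ≡.trans (coeff-⊕ (scale a q) (+ 0 ∷ (p ⊗ q)) 0)
      (≡.trans (ℤP.+-identityʳ _) (coeff-scale a q 0))

  coeff-drop : ∀ p i → coeff (drop 1 p) i ≡ coeff p (suc i)
  coeff-drop []      i = ≡.refl
  coeff-drop (a ∷ p) i = ≡.refl

  -- Constant term 1 or -1, that is, invertibility as an integral power series. It holds for (q;q)_m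
  -- and q^d - 1 and passes to the cyclotomic factors, so all of these can be cancelled.
  UnitConstant : Poly → Set
  UnitConstant p = ∃ λ u → u ℤ.* coeff p 0 ≡ + 1

  -- Power series division by p: an integer dividing p ⊗ r divides the coefficients of r one after another.
  content-⊗ : ∀ {p} → UnitConstant p → ∀ a r s → p ⊗ r ≐ C a ⊗ s → ∃ λ r′ → r ≐ C a ⊗ r′
  content-⊗ {p} (u , up≡1) a []      s h = [] , sym (⊗-zeroʳ (C a))
  content-⊗ {p} (u , up≡1) a (c ∷ r) s h =
    let r′ , r≐ = content-⊗ {p} (u , up≡1) a r (drop 1 s′) tail
    in c′ ∷ r′ , ext λ where
      zero    → ≡.trans c≡ac′ (≡.sym (coeff-C⊗ a (c′ ∷ r′) 0))
      (suc i) → ≡.trans (at r≐ i) (≡.trans (coeff-C⊗ a r′ i) (≡.sym (coeff-C⊗ a (c′ ∷ r′) (suc i))))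
    where
    c′ = u ℤ.* coeff s 0
    -- One step of the division: with c = a c′ the contribution of the leading coefficient is
    -- removed from s, and dropping the zero constant term leaves the same problem for `r`.
    s′ = s ⊖ scale c′ p
    product : ∀ i → c ℤ.* coeff p i ℤ.+ coeff (+ 0 ∷ (p ⊗ r)) i ≡ a ℤ.* coeff s i
    product i = ≡.trans (≡.sym expand) (≡.trans (at h i) (coeff-C⊗ a s i))
      where
      expand : coeff (p ⊗ (c ∷ r)) i ≡ c ℤ.* coeff p i ℤ.+ coeff (+ 0 ∷ (p ⊗ r)) i
      expand = ≡.trans (at (⊗-∷ʳ p c r) i) (≡.trans (coeff-⊕ (scale c p) _ i)
        (≡.cong (ℤ._+ coeff (+ 0 ∷ (p ⊗ r)) i) (coeff-scale c p i)))
    c≡ac′ : c ≡ a ℤ.* c′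
    c≡ac′ = ≡.trans (≡.sym (≡.trans (≡.cong (c ℤ.*_) up≡1) (ℤP.*-identityʳ c)))
      (≡.trans (lem₁ c u (coeff p 0)) (≡.trans (≡.cong (u ℤ.*_) (product 0)) (lem₂ u a (coeff s 0))))
      where
      lem₁ : ∀ c u p → c ℤ.* (u ℤ.* p) ≡ u ℤ.* (c ℤ.* p ℤ.+ + 0)
      lem₁ = ℤ-solve-∀
      lem₂ : ∀ u a s → u ℤ.* (a ℤ.* s) ≡ a ℤ.* (u ℤ.* s)
      lem₂ = ℤ-solve-∀
    tail : p ⊗ r ≐ C a ⊗ drop 1 s′
    tail = ext λ i → ≡.sym (≡.trans (coeff-C⊗ a (drop 1 s′) i) (≡.trans (≡.cong (a ℤ.*_) (s′-suc i))
      (≡.trans (lem₁ a (coeff s (suc i)) c′ (coeff p (suc i)))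
      (≡.trans (≡.cong₂ (λ x y → x ℤ.- y ℤ.* coeff p (suc i)) (≡.sym (product (suc i))) (≡.sym c≡ac′))
        (lem₂ c (coeff p (suc i)) (coeff (p ⊗ r) i))))))
      where
      s′-suc : ∀ i → coeff (drop 1 s′) i ≡ coeff s (suc i) ℤ.- c′ ℤ.* coeff p (suc i)
      s′-suc i = ≡.trans (coeff-drop s′ i) (≡.trans (coeff-⊕ s (neg (scale c′ p)) (suc i))
        (≡.cong (λ z → coeff s (suc i) ℤ.+ z) (≡.trans (coeff-neg (scale c′ p) (suc i))
            (≡.cong ℤ.-_ (coeff-scale c′ p (suc i))))))
      lem₁ : ∀ a s c p → a ℤ.* (s ℤ.- c ℤ.* p) ≡ a ℤ.* s ℤ.- a ℤ.* c ℤ.* p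
      lem₁ = ℤ-solve-∀
      lem₂ : ∀ c p x → c ℤ.* p ℤ.+ x ℤ.- c ℤ.* p ≡ x
      lem₂ = ℤ-solve-∀

  -- `content-⊗` with the integer 0: a polynomial divisible by 0 is zero.
  unit-regular : ∀ {p} → UnitConstant p → ∀ r → p ⊗ r ≐ [] → r ≐ []
  unit-regular {p} up r h with content-⊗ {p} up (+ 0) r [] (trans h (sym (⊗-zeroʳ (C (+ 0)))))
  ... | r′ , r≐ = trans r≐ (trans (C⊗ (+ 0) r′) (scale-0 r′))

  C-regular : ∀ k {p q} → C (+ suc k) ⊗ p ≐ C (+ suc k) ⊗ q → p ≐ q
  C-regular k {p} {q} h = ext λ i → ℤP.*-cancelˡ-≡ (+ suc k) (coeff p i) (coeff q i)
    (≡.trans (≡.sym (coeff-C⊗ (+ suc k) p i)) (≡.trans (at h i) (coeff-C⊗ (+ suc k) q i)))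

  open Arithmetic polyRing hiding (refl; sym; trans)

  q : Poly
  q = X^ 1

  q⊗ : ∀ p → q ⊗ p ≐ + 0 ∷ p
  q⊗ p = trans (0∷-⊗ one p) (∷-cong ≡.refl (⊗-identityˡ p))

  X^≐q^ : ∀ k → X^ k ≐ q ^ k
  X^≐q^ zero    = refl
  X^≐q^ (suc k) = trans (∷-cong ≡.refl (X^≐q^ k)) (sym (q⊗ (q ^ k)))

  ·1≐C : ∀ k → k ·1 ≐ C (+ k)
  ·1≐C zero    = sym 0∷[]≐[]
  ·1≐C (suc k) = trans (⊕-cong (·1≐C k) refl) (∷-cong (≡.cong +_ (ℕP.+-comm k 1)) refl)

  unitConstant-resp : ∀ {p r} → p ≐ r → UnitConstant p → UnitConstant r
  unitConstant-resp h (u , up≡1) = u , ≡.trans (≡.cong (u ℤ.*_) (≡.sym (at h 0))) up≡1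

  unitConstant-⊗ : ∀ {p r} → UnitConstant p → UnitConstant r → UnitConstant (p ⊗ r)
  unitConstant-⊗ {p} {r} (u , up≡1) (v , vr≡1) = u ℤ.* v ,
    ≡.trans (≡.cong (u ℤ.* v ℤ.*_) (constant-⊗ p r))
      (≡.trans (lem u v (coeff p 0) (coeff r 0)) (≡.cong₂ ℤ._*_ up≡1 vr≡1))
    where
    lem : ∀ u v a b → u ℤ.* v ℤ.* (a ℤ.* b) ≡ (u ℤ.* a) ℤ.* (v ℤ.* b)
    lem = ℤ-solve-∀

  -- If (k + 1) a = p w, then `content-⊗` makes k + 1 divide w, and the integer cancels
  -- coefficientwise.
  ℤ-regular : ∀ {p} → UnitConstant p → ∀ k {a} →
    Quotient._≋_ polyRing p (suc k ·1 ⊗ a) [] → Quotient._≋_ polyRing p a []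
  ℤ-regular {p} up k {a} (w , h) with content-⊗ {p} up (+ suc k) w a
    (trans (sym h) (⊗-congʳ a (·1≐C (suc k))))
  ... | w′ , w≐ = w′ , C-regular k (begin
    C (+ suc k) ⊗ a              ≈⟨ ⊗-congʳ a (·1≐C (suc k)) ⟨
    suc k ·1 ⊗ a                 ≈⟨ h ⟩
    p ⊗ w                        ≈⟨ ⊗-congˡ p w≐ ⟩
    p ⊗ (C (+ suc k) ⊗ w′)       ≈⟨ solve 3 (λ p c w → p :* (c :* w) := c :* (p :* w)) refl p (C (+ suc k)) w′ ⟩
    C (+ suc k) ⊗ (p ⊗ w′)       ∎)

  X^-1≐ : ∀ d → X^ d ⊖ one ≐ q ^ d - 1#
  X^-1≐ d = ⊕-congʳ (neg one) (X^≐q^ d)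

  q^-regular : ∀ d {a} → (q ^ suc d - 1#) ⊗ a ≐ [] → a ≐ []
  q^-regular d {a} = unit-regular {q ^ suc d - 1#} (unitConstant-resp {X^ (suc d) ⊖ one} (X^-1≐ (suc d))
      (-[1+ 0 ] , ≡.refl)) a

  unit-cancel : ∀ p {a b} → UnitConstant p → p ⊗ a ≐ p ⊗ b → a ≐ b
  unit-cancel p {a} {b} up h = x-y≈0⇒x≈y (unit-regular {p} up (a ⊖ b) (begin
    p ⊗ (a ⊖ b)       ≈⟨ solve 3 (λ p a b → p :* (a :- b) := p :* a :- p :* b) refl p a b ⟩
    p ⊗ a ⊖ p ⊗ b     ≈⟨ ⊕-congʳ (neg (p ⊗ b)) h ⟩
    p ⊗ b ⊖ p ⊗ b     ≈⟨ ⊕-inverseʳ (p ⊗ b) ⟩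
    []                ∎))

  -- The recursive binomials and the right-hand side in terms of the given definitions.

  open Gaussian polyRing q using (G; qfact; G-qfact)

  qpoch≐qfact : ∀ m → qpoch m ≐ qfact m
  qpoch≐qfact zero    = refl
  qpoch≐qfact (suc m) = ⊗-cong (qpoch≐qfact m) (⊖-congʳ one (X^≐q^ (suc m)))

  unitConstant-qpoch : ∀ m → UnitConstant (qpoch m)
  unitConstant-qpoch zero    = + 1 , ≡.refl
  unitConstant-qpoch (suc m) = unitConstant-⊗ {qpoch m} {one ⊖ X^ (suc m)} (unitConstant-qpoch m) (+ 1 , ≡.refl)

  -- Both satisfy the same equation with the factor (q;q)_k (q;q)_d, whose constant term is a unit.
  qBinomial≐G : ∀ {B} → IsQBinomial B → ∀ k d → B (k ℕ.+ d) k ≐ G (k ℕ.+ d) k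
  qBinomial≐G {B} isB k d = unit-cancel p (unitConstant-⊗ {qpoch k} {qpoch d} (unitConstant-qpoch k)
      (unitConstant-qpoch d)) (begin
    p ⊗ B (k ℕ.+ d) k                  ≈⟨ ⊗-comm p (B (k ℕ.+ d) k) ⟩
    B (k ℕ.+ d) k ⊗ p                  ≡⟨ ≡.cong (λ e → B (k ℕ.+ d) k ⊗ (qpoch k ⊗ qpoch e)) (ℕP.m+n∸m≡n k d) ⟨
    B (k ℕ.+ d) k ⊗ (qpoch k ⊗ qpoch (k ℕ.+ d ∸ k)) ≈⟨ ext (proj₁ (isB (k ℕ.+ d) k) (ℕP.m≤m+n k d)) ⟩
    qpoch (k ℕ.+ d)                    ≈⟨ qpoch≐qfact (k ℕ.+ d) ⟩
    qfact (k ℕ.+ d)                    ≈⟨ G-qfact k d ⟨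
    G (k ℕ.+ d) k ⊗ (qfact k ⊗ qfact d) ≈⟨ ⊗-congˡ (G (k ℕ.+ d) k) (⊗-cong (qpoch≐qfact k) (qpoch≐qfact d)) ⟨
    G (k ℕ.+ d) k ⊗ p                  ≈⟨ ⊗-comm (G (k ℕ.+ d) k) p ⟩
    p ⊗ G (k ℕ.+ d) k                  ∎)
    where p = qpoch k ⊗ qpoch d

  lhsSum≐ : ∀ {B} → IsQBinomial B → ∀ n → lhsSum B n ≐ ∑ n (λ k → q ^ k ⊗ G (k ℕ.+ k) k)
  lhsSum≐ {B} isB zero    = refl
  lhsSum≐ {B} isB (suc n) = ⊕-cong (lhsSum≐ {B} isB n) (⊗-cong (X^≐q^ n) (qBinomial≐G {B} isB n n))

  leg3-0 : ∀ n → n % 3 ≡ 0 → leg3 n ≡ + 0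
  leg3-0 n e rewrite e = ≡.refl
  leg3-1 : ∀ n → n % 3 ≡ 1 → leg3 n ≡ + 1
  leg3-1 n e rewrite e = ≡.refl
  leg3-2 : ∀ n → n % 3 ≡ 2 → leg3 n ≡ -[1+ 0 ]
  leg3-2 n e rewrite e = ≡.refl

  exponent : ∀ n e → n ℕ.* n ≡ suc (e ℕ.* 3) → (n ℕ.* n ∸ 1) / 3 ≡ e
  exponent n e h = ≡.trans (≡.cong (λ k → (k ∸ 1) / 3) h) (m*n/n≡m e 3)

  rhsTerm≐ : ∀ n {s} e → leg3 n ≡ s → n ℕ.* n ≡ suc (e ℕ.* 3) → rhsTerm n ≐ C s ⊗ q ^ e
  rhsTerm≐ n {s} e h h′ = trans (reflexive (≡.cong₂ (λ s e → C s ⊗ X^ e) h (exponent n e h′)))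
      (⊗-congˡ (C s) (X^≐q^ e))

  rhsTerm≐0 : ∀ n → leg3 n ≡ + 0 → rhsTerm n ≐ []
  rhsTerm≐0 n h = trans (reflexive (≡.cong (λ s → C s ⊗ X^ e) h)) (trans (C⊗ (+ 0) (X^ e)) (scale-0 (X^ e)))
    where e = (n ℕ.* n ∸ 1) / 3

  difference≐ : ∀ {B} → IsQBinomial B → ∀ n {t} → rhsTerm n ≐ t →
    lhsSum B n ⊖ rhsTerm n ≐ ∑ n (λ k → q ^ k ⊗ G (k ℕ.+ k) k) ⊖ t
  difference≐ {B} isB n h = ⊕-cong (lhsSum≐ {B} isB n) (neg-cong h)

  coprime-1 : ∀ {n} r → n ≡ 1 ℕ.+ 3 ℕ.* r → ∀ i → n ∣ 3 ℕ.* i → n ∣ i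
  coprime-1 r ≡.refl i n∣3i = ∣m+n∣m⇒∣n (≡.subst (1 ℕ.+ 3 ℕ.* r ∣_) (lem r i) (m∣m*n i)) (∣-trans n∣3i (n∣m*n r))
    where
    lem : ∀ r i → (1 ℕ.+ 3 ℕ.* r) ℕ.* i ≡ r ℕ.* (3 ℕ.* i) ℕ.+ i
    lem = solve-∀

  -- 2n = 3(1 + 2r) + 1 shows that 3 is invertible modulo n.
  coprime-2 : ∀ {n} r → n ≡ 2 ℕ.+ 3 ℕ.* r → ∀ i → n ∣ 3 ℕ.* i → n ∣ i
  coprime-2 r ≡.refl i n∣3i = ∣m+n∣m⇒∣n (≡.subst (2 ℕ.+ 3 ℕ.* r ∣_) (lem r i) (m∣m*n (2 ℕ.* i)))
      (∣-trans n∣3i (n∣m*n (1 ℕ.+ 2 ℕ.* r)))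
    where
    lem : ∀ r i → (2 ℕ.+ 3 ℕ.* r) ℕ.* (2 ℕ.* i) ≡ (1 ℕ.+ 2 ℕ.* r) ℕ.* (3 ℕ.* i) ℕ.+ i
    lem = solve-∀

  -- Cyclotomic polynomials and the three residue classes of n.

  module Cyclotomic (Φ : ℕ → Poly) (isΦ : IsCyclotomic Φ) where

    divProd-∣ : ∀ {n d} → suc d ∣ n → divProd Φ n (suc d) ≡ Φ (suc d) ⊗ divProd Φ n d
    divProd-∣ {n} {d} d∣n = ≡.cong (if_then Φ (suc d) ⊗ divProd Φ n d else divProd Φ n d)
        (dec-true (suc d ∣? n) d∣n)

    divProd-∤ : ∀ {n d} → suc d ∤ n → divProd Φ n (suc d) ≡ divProd Φ n d
    divProd-∤ {n} {d} d∤n = ≡.cong (if_then Φ (suc d) ⊗ divProd Φ n d else divProd Φ n d)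
        (dec-false (suc d ∣? n) d∤n)

    -- Every divisor of d divides n; `w` collects the Φ at the divisors of n up to m that do not
    -- divide d.
    divProd-factor : ∀ {d n} → d ∣ n → ∀ m → ∃ λ w → divProd Φ n m ≐ divProd Φ d m ⊗ w
    divProd-factor         d∣n zero    = one , sym (⊗-identityˡ one)
    divProd-factor {d} {n} d∣n (suc m) with divProd-factor d∣n m | suc m ∣? d | suc m ∣? n
    ... | w , h | yes m∣d | no m∤n  = contradiction (∣-trans m∣d d∣n) m∤n
    ... | w , h | yes m∣d | yes m∣n = w , (begin
      divProd Φ n (suc m)                   ≡⟨ divProd-∣ m∣n ⟩
      Φ (suc m) ⊗ divProd Φ n m             ≈⟨ ⊗-congˡ (Φ (suc m)) h ⟩
      Φ (suc m) ⊗ (divProd Φ d m ⊗ w)       ≈⟨ *-assoc (Φ (suc m)) (divProd Φ d m) w ⟨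
      Φ (suc m) ⊗ divProd Φ d m ⊗ w         ≡⟨ ≡.cong (_⊗ w) (divProd-∣ m∣d) ⟨
      divProd Φ d (suc m) ⊗ w               ∎)
    ... | w , h | no m∤d  | yes m∣n = Φ (suc m) ⊗ w , (begin
      divProd Φ n (suc m)                   ≡⟨ divProd-∣ m∣n ⟩
      Φ (suc m) ⊗ divProd Φ n m             ≈⟨ ⊗-congˡ (Φ (suc m)) h ⟩
      Φ (suc m) ⊗ (divProd Φ d m ⊗ w)       ≈⟨ solve 3 (λ a b c → a :* (b :* c) := b :* (a :* c)) refl (Φ (suc m))
          (divProd Φ d m) w ⟩
      divProd Φ d m ⊗ (Φ (suc m) ⊗ w)       ≡⟨ ≡.cong (_⊗ (Φ (suc m) ⊗ w)) (divProd-∤ m∤d) ⟨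
      divProd Φ d (suc m) ⊗ (Φ (suc m) ⊗ w) ∎)
    ... | w , h | no m∤d  | no m∤n  = w , (begin
      divProd Φ n (suc m)                   ≡⟨ divProd-∤ m∤n ⟩
      divProd Φ n m                         ≈⟨ h ⟩
      divProd Φ d m ⊗ w                     ≡⟨ ≡.cong (_⊗ w) (divProd-∤ m∤d) ⟨
      divProd Φ d (suc m) ⊗ w               ∎)

    divProd-beyond : ∀ d j → divProd Φ (suc d) (suc d ℕ.+ j) ≡ divProd Φ (suc d) (suc d)
    divProd-beyond d zero    = ≡.cong (divProd Φ (suc d)) (ℕP.+-identityʳ (suc d))
    divProd-beyond d (suc j) = ≡.trans (≡.cong (divProd Φ (suc d)) (ℕP.+-suc (suc d) j))
      (≡.trans (divProd-∤ (>⇒∤ (s≤s (s≤s (ℕP.m≤m+n d j))))) (divProd-beyond d j))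

    module _ (n′ : ℕ) where
      n = suc n′
      φ = Φ n
      D = divProd Φ n n′

      ΦD : φ ⊗ D ≐ X^ n ⊖ one
      ΦD = trans (reflexive (≡.sym (divProd-∣ ∣-refl))) (ext (isΦ n (s≤s z≤n)))

      -- The constant term of φ D = q^n - 1 is -1, so -D(0) inverts that of φ.
      unitConstant-Φ : UnitConstant φ
      unitConstant-Φ = ℤ.- coeff D 0 , ≡.trans (lem (coeff D 0) (coeff φ 0))
        (≡.cong ℤ.-_ (≡.trans (≡.sym (constant-⊗ φ D)) (at ΦD 0)))
        where
        lem : ∀ d f → (ℤ.- d) ℤ.* f ≡ ℤ.- (f ℤ.* d)
        lem = ℤ-solve-∀

      -- `D` runs over the proper divisors of n, among them all divisors of d + 1, whose product is
      -- q^(d+1) - 1.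
      D-factor : ∀ d → suc d ∣ n → suc d < n → ∃ λ w → D ≐ (q ^ suc d - 1#) ⊗ w
      D-factor d d∣n (s≤s d≤n′) with divProd-factor d∣n n′ | ℕP.m≤n⇒∃[o]m+o≡n d≤n′
      ... | w , h | j , d+j≡n′ = w , trans h (⊗-congʳ w (trans
        (reflexive (≡.trans (≡.cong (divProd Φ (suc d)) (≡.sym d+j≡n′)) (divProd-beyond d j)))
        (trans (ext (isΦ (suc d) (s≤s z≤n))) (X^-1≐ (suc d)))))

      root : RegularRoot (Quotient.quotient polyRing φ) n q
      root = CyclotomicFactor.regularRoot polyRing n′ q φ D
        (trans ΦD (X^-1≐ n)) D-factor q^-regular (ℤ-regular {φ} unitConstant-Φ)

      open Supercongruence polyRing n′ q φ root

      ε-regular : ∀ {u v} → ε ⊗ u ≐ ε ⊗ v → u ≐ v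
      ε-regular {u} {v} h = x-y≈0⇒x≈y (q^-regular n′ (begin
        (q ^ n - 1#) ⊗ (u ⊖ v)    ≈⟨ solve 3 (λ t u v → (t :- con (+ 1)) :* (u :- v) := (con (+ 1) :- t) :* v :-
            (con (+ 1) :- t) :* u) refl (q ^ n) u v ⟩
        ε ⊗ v ⊖ ε ⊗ u             ≈⟨ ⊖-congʳ (ε ⊗ v) h ⟩
        ε ⊗ v ⊖ ε ⊗ v             ≈⟨ ⊕-inverseʳ (ε ⊗ v) ⟩
        []                        ∎))

      open CentralSum ε-regular

      conclude : ∀ {a p} → p ≐ a → Mod²._≋_ (n ·1 ⊗ a) [] → (φ ⊗ φ) ∣ₚ p
      conclude p≐a h =
        let w , a≐ = ℤ-regular {φ ⊗ φ} (unitConstant-⊗ {φ} {φ} unitConstant-Φ unitConstant-Φ) n′ h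
        in w , at (trans p≐a a≐)

      module Residue {B : ℕ → ℕ → Poly} (isB : IsQBinomial B) where
        r = n / 3

        residue : ∀ s → n % 3 ≡ s → n ≡ s ℕ.+ 3 ℕ.* r
        residue s e = ≡.trans (m≡m%n+[m/n]*n n 3) (≡.cong₂ ℕ._+_ e (ℕP.*-comm r 3))

        case-0 : n % 3 ≡ 0 → (φ ⊗ φ) ∣ₚ (lhsSum B n ⊖ rhsTerm n)
        case-0 e = conclude {S} {lhsSum B n ⊖ rhsTerm n}
          (trans (difference≐ {B} isB n {[]} (rhsTerm≐0 n (leg3-0 n e))) (⊕-identityʳ S))
          (S-0-mod-3 r (residue 0 e))

        case-1 : n % 3 ≡ 1 → (φ ⊗ φ) ∣ₚ (lhsSum B n ⊖ rhsTerm n)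
        case-1 e = conclude {S ⊖ q ^ f} {lhsSum B n ⊖ rhsTerm n}
          (difference≐ {B} isB n {q ^ f} (trans (rhsTerm≐ n f (leg3-1 n e) square) (⊗-identityˡ (q ^ f))))
          (S-1-mod-3 (coprime-1 r n≡) r f n≡ ≡.refl)
          where
          -- (n² - 1)/3 for n = 3r + 1.
          f = r ℕ.+ n ℕ.* r
          n≡ : n ≡ 1 ℕ.+ 3 ℕ.* r
          n≡ = residue 1 e
          square : n ℕ.* n ≡ suc (f ℕ.* 3)
          square = ≡.subst (λ k → k ℕ.* k ≡ suc ((r ℕ.+ k ℕ.* r) ℕ.* 3)) (≡.sym n≡) (lem r)
            where
            lem : ∀ r → (1 ℕ.+ 3 ℕ.* r) ℕ.* (1 ℕ.+ 3 ℕ.* r) ≡ 1 ℕ.+ (r ℕ.+ (1 ℕ.+ 3 ℕ.* r) ℕ.* r) ℕ.* 3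
            lem = solve-∀

        case-2 : n % 3 ≡ 2 → (φ ⊗ φ) ∣ₚ (lhsSum B n ⊖ rhsTerm n)
        case-2 e = conclude {S ⊕ q ^ f} {lhsSum B n ⊖ rhsTerm n}
          (trans (difference≐ {B} isB n {C -[1+ 0 ] ⊗ q ^ f} (rhsTerm≐ n f (leg3-2 n e) square))
            (⊕-congˡ S (solve 1 (λ u → :- (:- con (+ 1) :* u) := u) refl (q ^ f))))
          (S-2-mod-3 (coprime-2 r n≡) r f n≡ sum)
          where
          -- (n² - 1)/3 = (3r + 1)(r + 1) for n = 3r + 2.
          f = 3 ℕ.* (r ℕ.* r) ℕ.+ 4 ℕ.* r ℕ.+ 1
          n≡ : n ≡ 2 ℕ.+ 3 ℕ.* r
          n≡ = residue 2 e
          square : n ℕ.* n ≡ suc (f ℕ.* 3)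
          square = ≡.trans (≡.cong (λ k → k ℕ.* k) n≡) (lem r)
            where
            lem : ∀ r → (2 ℕ.+ 3 ℕ.* r) ℕ.* (2 ℕ.+ 3 ℕ.* r) ≡ 1 ℕ.+ (3 ℕ.* (r ℕ.* r) ℕ.+ 4 ℕ.* r ℕ.+ 1) ℕ.* 3
            lem = solve-∀
          sum : f ℕ.+ suc r ≡ n ℕ.* suc r
          sum = ≡.trans (lem r) (≡.cong (ℕ._* suc r) (≡.sym n≡))
            where
            lem : ∀ r → 3 ℕ.* (r ℕ.* r) ℕ.+ 4 ℕ.* r ℕ.+ 1 ℕ.+ (1 ℕ.+ r) ≡ (2 ℕ.+ 3 ℕ.* r) ℕ.* (1 ℕ.+ r)
            lem = solve-∀

theorem1p2 : (Φ : ℕ → Poly) → IsCyclotomic Φ →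
    (B : ℕ → ℕ → Poly) → IsQBinomial B →
    (n : ℕ) → 1 ≤ n →
    (Φ n ⊗ Φ n) ∣ₚ (lhsSum B n ⊖ rhsTerm n)
theorem1p2 Φ isΦ B isB (suc n′) _ = by-residue (suc n′ % 3) ≡.refl (m%n<n (suc n′) 3)
  where
  by-residue : ∀ s → suc n′ % 3 ≡ s → s < 3 → (Φ (suc n′) ⊗ Φ (suc n′)) ∣ₚ (lhsSum B (suc n′) ⊖ rhsTerm (suc n′))
  by-residue 0 e _ = Polynomials.Cyclotomic.Residue.case-0 Φ isΦ n′ {B} isB e
  by-residue 1 e _ = Polynomials.Cyclotomic.Residue.case-1 Φ isΦ n′ {B} isB e
  by-residue 2 e _ = Polynomials.Cyclotomic.Residue.case-2 Φ isΦ n′ {B} isB e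
  by-residue (suc (suc (suc _))) _ (s≤s (s≤s (s≤s ())))
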